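{- Let $n\ge 2$, and for $i\ge -1$ let $\mathfrak{M}_i$ be the free $\mathbb{Z}$-module spanned by $\mathcal{N}_i$. Then $\mathfrak{M}_{ -1}=\mathfrak{N}_{ -1}$, and for every $i\ge 0$, $\mathfrak{M}_i$ is a homogeneous Lie subring of $\mathfrak{L}(n)$ and \[\mathfrak{M}_i=N_{\mathfrak{L}(n)}(\mathfrak{M}_{i-1})=\mathfrak{N}_i.\]
   Context: Let $n\ge 2$ be an integer. A partition is a sequence $\Lambda=(\lambda_t)_{t\ge 1}$ of non-negative integers with finite support; $\mathrm{wt}(\Lambda)=\sum_t t\lambda_t$; $x^\Lambda=\prod_t x_t^{\lambda_t}$ (monomial in commuting indeterminates), $\deg(x^\Lambda)=\sum_t\lambda_t$. $\mathrm{Part}(j)$ is the set of partitions with $\lambda_t=0$ for $t>j$; $\partial_k$ is the partial derivative with respect to $x_k$. Let $\mathcal{B}=\{x^\Lambda\partial_k:1\le k\le n,\ \Lambda\in\mathrm{Part}(k-1)\}$ and let $\mathfrak{L}(n)$ be the free $\mathbb{Z}$-module with basis $\mathcal{B}$, with Lie bracket defined on $\mathcal{B}$ by $[x^\Lambda\partial_k,x^\Theta\partial_j]=\partial_j(x^\Lambda)x^\Theta\partial_k$ if $j<k$, $=-x^\Lambda\partial_k(x^\Theta)\partial_j$ if $j>k$, $=0$ if $j=k$, extended bilinearly. A Lie subring of $\mathfrak{L}(n)$ is homogeneous if it is the free $\mathbb{Z}$-module spanned by some subset of $\mathcal{B}$. The idealizer of a Lie subring $\mathfrak{h}$ is $N_{\mathfrak{L}(n)}(\mathfrak{h})=\{y\in\mathfrak{L}(n):[y,z]\in\mathfrak{h}\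 \forall z\in\mathfrak{h}\}$. The idealizer chain: $\mathfrak{N}_{ -1}=\mathbb{Z}\partial_1+\dots+\mathbb{Z}\partial_n$, $\mathfrak{N}_i=N_{\mathfrak{L}(n)}(\mathfrak{N}_{i-1})$ for $i\ge0$. For an integer $i\ge -1$ let $r_i\in\{1,\dots,n-1\}$ with $i\equiv r_i\pmod{n-1}$ and $h_i=\lfloor (i-1)/(n-1)\rfloor+1$. For $x^\Lambda\partial_k\in\mathcal{B}$ define $\mathrm{WD}(x^\Lambda\partial_k)=\mathrm{wt}(\Lambda)-\deg(x^\Lambda)+n-k$ and $\mathrm{lev}_i(x^\Lambda\partial_k)=h_i\,\mathrm{WD}(x^\Lambda\partial_k)+\deg(x^\Lambda)-1$. For $i\ge -1$ let $\mathcal{N}_i=\{b\in\mathcal{B}: \mathrm{lev}_j(b)\le j \text{ for some integer } j \text{ with } -1\le j\le i\}$. -}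

module Defs where

open import Data.Nat as ℕ using (ℕ; zero; suc)
open import Data.Nat.Properties using (<-cmp)
open import Data.Integer as ℤ using (ℤ; +_; _/ℕ_)
open import Data.Fin as Fin using (Fin; toℕ)
open import Data.Vec as Vec using (Vec; []; _∷_; lookup; updateAt; zipWith; replicate)
open import Data.Vec.Properties using (≡-dec)
open import Data.List as List using (List; []; _∷_; _++_; concatMap; map)
open import Data.List.Relation.Unary.All using (All)
open import Data.Product using (Σ; _×_; _,_; ∃)
open import Data.Bool using (Bool; true; false; _∧_; if_then_else_)
open import Relation.Nullary using (¬_)
open import Relation.Nullary.Decidable using (⌊_⌋)
open import Relation.Binary.PropositionalEquality using (_≡_)
open import Relation.Binary using (tri<; tri≈; tri>)
open import Function.Bundles using (_⇔_)

-- Monomials x^Λ ∂_k.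
-- A "raw" basis symbol x^Λ ∂_k is a pair (k , Λ) where
--   * k : Fin n is 0-indexed: it represents the derivation ∂_{toℕ k + 1};
--   * Λ : Vec ℕ n lists the exponents: lookup Λ t = λ_{toℕ t + 1}.
-- Exponents λ_s with s > n are always 0 for elements of 𝓑 (Part(k-1), k ≤ n),
-- so a vector of length n suffices.

record Raw (n : ℕ) : Set where
  constructor mon
  field
    dk  : Fin n
    exp : Vec ℕ n
open Raw public

kOf : ∀ {n} → Raw n → ℕ
kOf b = suc (toℕ (dk b))

-- (k , Λ) belongs to 𝓑, i.e. Λ ∈ Part(k-1): λ_s = 0 for s > k - 1,
-- i.e. lookup Λ t = 0 whenever toℕ t + 1 > k - 1, i.e. toℕ t ≥ toℕ (dk b).
InB : ∀ {n} → Raw n → Set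
InB {n} b = (t : Fin n) → toℕ (dk b) ℕ.≤ toℕ t → lookup (exp b) t ≡ 0

_==_ : ∀ {n} → Raw n → Raw n → Bool
mon k Λ == mon j Θ = ⌊ k Fin.≟ j ⌋ ∧ ⌊ ≡-dec ℕ._≟_ Λ Θ ⌋

-- Elements of 𝔏(n): finite formal ℤ-linear combinations of basis symbols.
-- An element is represented by a list of terms (coefficient , symbol);
-- two representations denote the same element iff all coefficients agree.

FSum : ℕ → Set
FSum n = List (ℤ × Raw n)

Elt : ∀ {n} → FSum n → Set
Elt y = All (λ { (c , b) → InB b }) y

coeff : ∀ {n} → FSum n → Raw n → ℤ
coeff [] b = + 0
coeff ((c , b′) ∷ y) b = (if b′ == b then c else + 0) ℤ.+ coeff y b

_≈_ : ∀ {n} → FSum n → FSum n → Set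
y ≈ z = ∀ b → coeff y b ≡ coeff z b

0L : ∀ {n} → FSum n
0L = []

_+L_ : ∀ {n} → FSum n → FSum n → FSum n
y +L z = y ++ z

-L_ : ∀ {n} → FSum n → FSum n
-L y = map (λ { (c , b) → (ℤ.- c , b) }) y

-- Lie bracket on basis symbols.
--   j < k :  [x^Λ∂_k , x^Θ∂_j] =  ∂_j(x^Λ) x^Θ ∂_k = λ_j x^(Λ - e_j + Θ) ∂_k
--   j > k :  [x^Λ∂_k , x^Θ∂_j] = - x^Λ ∂_k(x^Θ) ∂_j = -θ_k x^(Λ + Θ - e_k) ∂_j
--   j = k :  0
-- (When λ_j = 0, resp. θ_k = 0, the term has coefficient 0.)

decr : ∀ {n} → Vec ℕ n → Fin n → Vec ℕ n
decr Λ t = updateAt Λ t ℕ.pred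

brB : ∀ {n} → Raw n → Raw n → FSum n
brB (mon k Λ) (mon j Θ) with <-cmp (toℕ j) (toℕ k)
... | tri< _ _ _ = (+ lookup Λ j , mon k (zipWith ℕ._+_ (decr Λ j) Θ)) ∷ []
... | tri≈ _ _ _ = []
... | tri> _ _ _ = (ℤ.- (+ lookup Θ k) , mon j (zipWith ℕ._+_ Λ (decr Θ k))) ∷ []

scale : ∀ {n} → ℤ → FSum n → FSum n
scale c y = map (λ { (d , b) → (c ℤ.* d , b) }) y

br : ∀ {n} → FSum n → FSum n → FSum n
br y z = concatMap (λ { (c , b) → concatMap (λ { (d , b′) → scale (c ℤ.* d) (brB b b′) }) z }) y

Pred𝔏 : ℕ → Set₁
Pred𝔏 n = FSum n → Set

_≐_ : ∀ {n} → Pred𝔏 n → Pred𝔏 n → Set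
_≐_ {n} A B = (y : FSum n) → Elt y → (A y ⇔ B y)

Span : ∀ {n} → (Raw n → Set) → Pred𝔏 n
Span S y = Σ (FSum _) λ z → All (λ { (c , b) → S b }) z × (z ≈ y)

Idealizer : ∀ {n} → Pred𝔏 n → Pred𝔏 n
Idealizer H y = ∀ z → Elt z → H z → H (br y z)

IsLieSubring : ∀ {n} → Pred𝔏 n → Set
IsLieSubring {n} H =
  H 0L ×
  (∀ y z → Elt y → Elt z → H y → H z → H (y +L z)) ×
  (∀ y → Elt y → H y → H (-L y)) ×
  (∀ y z → Elt y → Elt z → H y → H z → H (br y z))

IsHomogeneous : ∀ {n} → Pred𝔏 n → Set₁
IsHomogeneous {n} H = Σ (Raw n → Set) λ S → (∀ b → S b → InB b) × (H ≐ Span S)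

-- Idealizer chain, indexed by m = i + 1 (so m = 0 is 𝔑_{-1}).

IsDeriv : ∀ {n} → Raw n → Set
IsDeriv {n} b = exp b ≡ replicate n 0

chain : ∀ n → ℕ → Pred𝔏 n
chain n zero = Span IsDeriv
chain n (suc m) = Idealizer (chain n m)

-- floor division by d (only used with d = n - 1 ≥ 1).
floorDiv : ℤ → ℕ → ℤ
floorDiv x zero = + 0
floorDiv x (suc d) = x /ℕ suc d

hh : ℕ → ℤ → ℤ
hh n i = floorDiv (i ℤ.- + 1) (n ℕ.∸ 1) ℤ.+ + 1

-- wt(Λ) = Σ_t t λ_t ,  deg(x^Λ) = Σ_t λ_t   (Vec positions are t - 1)
wt : ∀ {n} → Vec ℕ n → ℕ
wt Λ = Vec.sum (zipWith ℕ._*_ (Vec.tabulate (λ t → suc (toℕ t))) Λ)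

deg : ∀ {n} → Vec ℕ n → ℕ
deg Λ = Vec.sum Λ

WD : ∀ {n} → Raw n → ℤ
WD {n} b = + wt (exp b) ℤ.- + deg (exp b) ℤ.+ + n ℤ.- + kOf b

lev : ∀ {n} → ℤ → Raw n → ℤ
lev {n} i b = hh n i ℤ.* WD b ℤ.+ + deg (exp b) ℤ.- + 1

-- 𝒩_i for i = m - 1: b ∈ 𝓑 with lev_j(b) ≤ j for some -1 ≤ j ≤ i,
-- written j = j′ - 1 with 0 ≤ j′ ≤ m.
𝒩 : ∀ n → ℕ → Raw n → Set
𝒩 n m b = InB b × ∃ λ j′ → j′ ℕ.≤ m × lev (+ j′ ℤ.- + 1) b ℤ.≤ (+ j′ ℤ.- + 1)

𝔐 : ∀ n → ℕ → Pred𝔏 n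
𝔐 n m = Span (𝒩 n m)

{-# OPTIONS --safe #-}

-- For b = x^Λ ∂_k put u(b) = n - 1 - WD(b) = (k - 1) - Σ (t - 1) λ_t and d(b) = deg(x^Λ) - 1.
-- Both are additive: if [b, c] is a non-zero multiple of e, then u(e) = u(b) + u(c) and
-- d(e) = d(b) + d(c). For i = r + h(n - 1) with h ≥ 0 and 0 ≤ r ≤ n - 1, the set 𝒩_i is cut out
-- of 𝓑 by "d ≤ hu or d + (n - 1) ≤ (h + 1)u + r", so adding inequalities shows that
-- [𝒩_i, 𝒩_{i-1}] ⊆ 𝔐_{i-1}.
-- Conversely, if [b, c] ∈ 𝔐_{i-1} for all c ∈ 𝒩_{i-1}, then b ∈ 𝒩_i, as is seen by testing with a
-- single c: one of the elements x_1^h x_q ∂_{q+1}, which have u = 1 and d = h, or ∂_1 if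
-- b = x_1^m ∂_n. Finally, for fixed c ∈ 𝓑, distinct b ∈ 𝓑 have their brackets with c supported on
-- distinct basis elements, so the idealizer of a homogeneous subring is homogeneous.

module Submission where

open import Defs
open import Data.Bool using (true; false; _∧_; if_then_else_)
open import Data.Fin as Fin using (Fin; toℕ)
import Data.Fin.Properties as Fin
open import Data.Integer as ℤ using (ℤ; +_; 0ℤ; 1ℤ)
import Data.Integer.Properties as ℤ
open import Data.Integer.Tactic.RingSolver using (solve-∀)
open import Data.List using ([]; _∷_; _++_; filter; length; concatMap)
open import Data.List.Properties using (length-filter)
open import Data.List.Relation.Unary.All as All using (All; []; _∷_)
import Data.List.Relation.Unary.All.Properties as All
open import Data.Nat as ℕ using (ℕ; zero; suc; _≤_; z≤n; s≤s)
open import Data.Nat.Divisibility using (divides-refl)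
open import Data.Nat.DivMod
  using (+-distrib-/-∣ʳ; m<n⇒m/n≡0; m*n/n≡m; m≡m%n+[m/n]*n; m%n<n)
import Data.Nat.Properties as ℕ
import Data.Nat.Tactic.RingSolver as ℕSolver
open import Data.Product using (∃; _×_; _,_; proj₁; proj₂)
open import Data.Sum using (_⊎_; inj₁; inj₂; [_,_]′)
open import Data.Vec as Vec using (Vec; []; _∷_; lookup; zipWith; replicate; tabulate)
import Data.Vec.Properties as Vec
open import Function using (_∘_; const; id)
open import Function.Bundles using (mk⇔; Equivalence)
open import Relation.Binary using (tri<; tri≈; tri>)
open import Relation.Binary.PropositionalEquality
open import Relation.Nullary using (¬_; Dec; yes; no; contradiction; ¬?)
open import Relation.Nullary.Decidable
  using (map′; isYes≗does; _×-dec_; _→-dec_; dec-true; dec-false; decidable-stable)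
open import Relation.Unary using (Decidable)

private
  variable
    n : ℕ

-- Formal sums

-- Abstract, so that with-abstraction finds x ≟ᴿ b inside unfolded goals.
abstract
  _≟ᴿ_ : (b b′ : Raw n) → Dec (b ≡ b′)
  mon k Λ ≟ᴿ mon j Θ =
    map′ (λ { (refl , refl) → refl }) (λ { refl → refl , refl })
      ((k Fin.≟ j) ×-dec Vec.≡-dec ℕ._≟_ Λ Θ)

  ==-does : (b b′ : Raw n) → (b == b′) ≡ Dec.does (b ≟ᴿ b′)
  ==-does (mon k Λ) (mon j Θ) = cong₂ _∧_ (isYes≗does (k Fin.≟ j)) (isYes≗does (Vec.≡-dec ℕ._≟_ Λ Θ))

==-refl : (b : Raw n) → (b == b) ≡ true
==-refl b = trans (==-does b b) (dec-true (b ≟ᴿ b) refl)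

==-≢ : {b b′ : Raw n} → b ≢ b′ → (b == b′) ≡ false
==-≢ {b = b} {b′} b≢b′ = trans (==-does b b′) (dec-false (b ≟ᴿ b′) b≢b′)

-- The linear extension of `F` to formal sums. By `coeff-br`, each coefficient of a bracket is a
-- nested linear extension.
eval : (Raw n → ℤ) → FSum n → ℤ
eval F []            = 0ℤ
eval F ((c , b) ∷ y) = c ℤ.* F b ℤ.+ eval F y

coeff-∷-≡ : ∀ c (b : Raw n) y → coeff ((c , b) ∷ y) b ≡ c ℤ.+ coeff y b
coeff-∷-≡ c b y rewrite ==-refl b = refl

coeff-∷-≢ : ∀ c {b b′ : Raw n} y → b′ ≢ b → coeff ((c , b′) ∷ y) b ≡ coeff y b
coeff-∷-≢ c y b′≢b rewrite ==-≢ b′≢b = ℤ.+-identityˡ _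

coeff-++ : ∀ (y z : FSum n) b → coeff (y ++ z) b ≡ coeff y b ℤ.+ coeff z b
coeff-++ []             z b = sym (ℤ.+-identityˡ _)
coeff-++ ((c , b′) ∷ y) z b =
  trans (cong (ℤ._+_ t) (coeff-++ y z b)) (sym (ℤ.+-assoc t (coeff y b) (coeff z b)))
  where t = if b′ == b then c else + 0

coeff-neg : ∀ (y : FSum n) b → coeff (-L y) b ≡ ℤ.- coeff y b
coeff-neg []             b = refl
coeff-neg ((c , b′) ∷ y) b with b′ == b
... | true  = trans (cong (ℤ._+_ (ℤ.- c)) (coeff-neg y b)) (sym (ℤ.neg-distrib-+ c _))
... | false = trans (cong (ℤ._+_ 0ℤ) (coeff-neg y b)) (sym (ℤ.neg-distrib-+ 0ℤ (coeff y b)))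

coeff-scale : ∀ c (y : FSum n) b → coeff (scale c y) b ≡ c ℤ.* coeff y b
coeff-scale c []             b = sym (ℤ.*-zeroʳ c)
coeff-scale c ((d , b′) ∷ y) b with b′ == b
... | true  = trans (cong (ℤ._+_ (c ℤ.* d)) (coeff-scale c y b)) (sym (ℤ.*-distribˡ-+ c d _))
... | false = trans (cong (ℤ._+_ 0ℤ) (coeff-scale c y b))
                    (trans (ℤ.+-identityˡ (c ℤ.* coeff y b)) (cong (c ℤ.*_) (sym (ℤ.+-identityˡ (coeff y b)))))

brCoeff : Raw n → Raw n → Raw n → ℤ
brCoeff e b b′ = coeff (brB b b′) e

coeff-concatMap : ∀ (f : ℤ × Raw n → FSum n) F e → (∀ c b → coeff (f (c , b)) e ≡ c ℤ.* F b) →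
  ∀ y → coeff (concatMap f y) e ≡ eval F y
coeff-concatMap f F e f≡F []            = refl
coeff-concatMap f F e f≡F ((c , b) ∷ y) =
  trans (coeff-++ (f (c , b)) (concatMap f y) e)
        (cong₂ ℤ._+_ (f≡F c b) (coeff-concatMap f F e f≡F y))

eval-*ˡ : ∀ c (F : Raw n → ℤ) y → eval (λ b → c ℤ.* F b) y ≡ c ℤ.* eval F y
eval-*ˡ c F []            = sym (ℤ.*-zeroʳ c)
eval-*ˡ c F ((d , b) ∷ y) rewrite eval-*ˡ c F y = factor c d (F b) (eval F y)
  where
  factor : ∀ x y f g → y ℤ.* (x ℤ.* f) ℤ.+ x ℤ.* g ≡ x ℤ.* (y ℤ.* f ℤ.+ g)
  factor = solve-∀

coeff-br : ∀ (y z : FSum n) e →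
  coeff (br y z) e ≡ eval (λ b → eval (brCoeff e b) z) y
coeff-br y z e = coeff-concatMap _ _ e (λ c b →
  trans
    (coeff-concatMap _ (λ b′ → c ℤ.* brCoeff e b b′) e (λ d b′ →
      trans (coeff-scale (c ℤ.* d) (brB b b′) e) (rearrange c d (brCoeff e b b′))) z)
    (eval-*ˡ c (brCoeff e b) z)) y
  where
  rearrange : ∀ x y f → x ℤ.* y ℤ.* f ≡ y ℤ.* (x ℤ.* f)
  rearrange = solve-∀

delete : Raw n → FSum n → FSum n
delete b = filter (λ { (_ , b′) → ¬? (b′ ≟ᴿ b) })

coeff-delete-≢ : ∀ {b b′ : Raw n} y → b′ ≢ b → coeff (delete b y) b′ ≡ coeff y b′
coeff-delete-≢ []             b′≢b = refl
coeff-delete-≢ {b = b} {b′} ((c , x) ∷ y) b′≢b with x ≟ᴿ b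
... | no  _    = cong (ℤ._+_ (if x == b′ then c else + 0)) (coeff-delete-≢ y b′≢b)
... | yes refl = trans (coeff-delete-≢ y b′≢b) (sym (coeff-∷-≢ c y (b′≢b ∘ sym)))

coeff-delete-≡ : ∀ (b : Raw n) y → coeff (delete b y) b ≡ 0ℤ
coeff-delete-≡ b []            = refl
coeff-delete-≡ b ((c , x) ∷ y) with x ≟ᴿ b
... | no x≢b = trans (coeff-∷-≢ c (delete b y) x≢b) (coeff-delete-≡ b y)
... | yes _  = coeff-delete-≡ b y

-- A list may repeat a symbol, and its terms may cancel. Collecting all terms with the same symbol
-- makes the total coefficient appear, which is all that `≈` sees.
eval-delete : ∀ F (b : Raw n) y → eval F y ≡ coeff y b ℤ.* F b ℤ.+ eval F (delete b y)
eval-delete F b []            = refl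
eval-delete F b ((c , x) ∷ y) with x ≟ᴿ b
... | yes refl rewrite ==-refl x | eval-delete F x y = collect c (coeff y x) (F x) _
  where
  collect : ∀ p q f g → p ℤ.* f ℤ.+ (q ℤ.* f ℤ.+ g) ≡ (p ℤ.+ q) ℤ.* f ℤ.+ g
  collect = solve-∀
... | no x≢b rewrite ==-≢ x≢b | eval-delete F b y = swap (c ℤ.* F x) (coeff y b) (F b) _
  where
  swap : ∀ p q f g → p ℤ.+ (q ℤ.* f ℤ.+ g) ≡ (0ℤ ℤ.+ q) ℤ.* f ℤ.+ (p ℤ.+ g)
  swap = solve-∀

eval-vanishes : ∀ F (y : FSum n) → (∀ b → coeff y b ≢ 0ℤ → F b ≡ 0ℤ) → eval F y ≡ 0ℤ
eval-vanishes F y = bounded (length y) y ℕ.≤-refl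
  where
  -- Deleting every occurrence of the head symbol is not structural recursion on the list, so a
  -- bound `l` on its length drives the induction.
  bounded : ∀ l y → length y ℕ.≤ l → (∀ b → coeff y b ≢ 0ℤ → F b ≡ 0ℤ) → eval F y ≡ 0ℤ
  bounded l       []            _         _  = refl
  bounded (suc l) ((c , b) ∷ y) (s≤s y≤l) F0 = begin
    eval F Y                                 ≡⟨ eval-delete F b Y ⟩
    coeff Y b ℤ.* F b ℤ.+ eval F (delete b Y) ≡⟨ cong₂ ℤ._+_ head tail ⟩
    0ℤ                                       ∎
    where
    open ≡-Reasoning
    Y = (c , b) ∷ y
    head : coeff Y b ℤ.* F b ≡ 0ℤ
    head with coeff Y b ℤ.≟ 0ℤ
    ... | yes z = cong (ℤ._* F b) z
    ... | no nz = trans (cong (coeff Y b ℤ.*_) (F0 b nz)) (ℤ.*-zeroʳ (coeff Y b))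
    shorter : length (delete b Y) ℕ.≤ l
    shorter with b ≟ᴿ b
    ... | yes _  = ℕ.≤-trans (length-filter _ y) y≤l
    ... | no b≢b = contradiction refl b≢b
    tail : eval F (delete b Y) ≡ 0ℤ
    tail = bounded l (delete b Y) shorter λ b′ nz →
      F0 b′ λ z → nz (zero-after b′ z)
      where
      zero-after : ∀ b′ → coeff Y b′ ≡ 0ℤ → coeff (delete b Y) b′ ≡ 0ℤ
      zero-after b′ z with b′ ≟ᴿ b
      ... | yes refl = coeff-delete-≡ b′ Y
      ... | no  ≢b   = trans (coeff-delete-≢ Y ≢b) z

eval-concentrated : ∀ F (y : FSum n) b →
  (∀ b′ → coeff y b′ ≢ 0ℤ → F b′ ≢ 0ℤ → b′ ≡ b) → eval F y ≡ coeff y b ℤ.* F b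
eval-concentrated F y b only-b = begin
  eval F y                                  ≡⟨ eval-delete F b y ⟩
  coeff y b ℤ.* F b ℤ.+ eval F (delete b y)  ≡⟨ cong (ℤ._+_ (coeff y b ℤ.* F b)) rest ⟩
  coeff y b ℤ.* F b ℤ.+ 0ℤ                   ≡⟨ ℤ.+-identityʳ _ ⟩
  coeff y b ℤ.* F b                         ∎
  where
  open ≡-Reasoning
  rest : eval F (delete b y) ≡ 0ℤ
  rest = eval-vanishes F (delete b y) λ b′ nz →
    decidable-stable (F b′ ℤ.≟ 0ℤ) λ F≢0 → nz (vanish b′ F≢0)
    where
    vanish : ∀ b′ → F b′ ≢ 0ℤ → coeff (delete b y) b′ ≡ 0ℤ
    vanish b′ F≢0 with b′ ≟ᴿ b
    ... | yes refl = coeff-delete-≡ b′ y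
    ... | no  ≢b   = trans (coeff-delete-≢ y ≢b)
      (decidable-stable (coeff y b′ ℤ.≟ 0ℤ) λ nz → ≢b (only-b b′ nz F≢0))

-- Supports and spans

SupportedOn : (Raw n → Set) → Pred𝔏 n
SupportedOn S y = ∀ b → coeff y b ≢ 0ℤ → S b

All⇒SupportedOn : ∀ {S : Raw n → Set} y → All (S ∘ proj₂) y → SupportedOn S y
All⇒SupportedOn []            []        b nz = contradiction refl nz
All⇒SupportedOn ((c , x) ∷ y) (Sx ∷ Sy) b nz with x ≟ᴿ b
... | yes refl = Sx
... | no  x≢b  = All⇒SupportedOn y Sy b (nz ∘ trans (coeff-∷-≢ c y x≢b))

Span⇒SupportedOn : ∀ {S : Raw n → Set} {y} → Span S y → SupportedOn S y
Span⇒SupportedOn (z , Sz , z≈y) b nz =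
  All⇒SupportedOn z (All.map id Sz) b (nz ∘ trans (sym (z≈y b)))

-- Filtering by `S` keeps or drops all terms of a symbol together, and a dropped symbol has total
-- coefficient 0 because the support lies in `S`.
SupportedOn⇒Span : ∀ {S : Raw n → Set} → Decidable S → ∀ {y} → SupportedOn S y → Span S y
SupportedOn⇒Span {n} {S} S? {y} supp =
  restrict y , All.map id (All.all-filter S?′ y) , same
  where
  S?′ : Decidable (λ (t : ℤ × Raw n) → S (proj₂ t))
  S?′ t = S? (proj₂ t)
  restrict : FSum n → FSum n
  restrict = filter S?′
  kept : ∀ y b → S b → coeff (restrict y) b ≡ coeff y b
  kept []            b Sb = refl
  kept ((c , x) ∷ y) b Sb with S? x
  ... | yes _  = cong (ℤ._+_ (if x == b then c else + 0)) (kept y b Sb)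
  ... | no ¬Sx = trans (kept y b Sb) (sym (coeff-∷-≢ c {b} {x} y λ x≡b → ¬Sx (subst S (sym x≡b) Sb)))
  same : restrict y ≈ y
  same b with S? b
  ... | yes Sb = kept y b Sb
  ... | no ¬Sb = trans
    (decidable-stable (_ ℤ.≟ 0ℤ) λ nz → ¬Sb (All⇒SupportedOn (restrict y) (All.all-filter S?′ y) b nz))
    (sym (decidable-stable (coeff y b ℤ.≟ 0ℤ) λ nz → ¬Sb (supp b nz)))

-- The bracket on basis symbols

-- Br b c e: the bracket [b, c] is a non-zero multiple of the basis symbol e.
data Br {n : ℕ} : Raw n → Raw n → Raw n → Set where
  down : ∀ {k j Λ Θ} → toℕ j ℕ.< toℕ k → lookup Λ j ≢ 0 →
         Br (mon k Λ) (mon j Θ) (mon k (zipWith ℕ._+_ (decr Λ j) Θ))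
  up   : ∀ {k j Λ Θ} → toℕ k ℕ.< toℕ j → lookup Θ k ≢ 0 →
         Br (mon k Λ) (mon j Θ) (mon j (zipWith ℕ._+_ Λ (decr Θ k)))

coeff-singleton : ∀ c (b e : Raw n) → coeff ((c , b) ∷ []) e ≢ 0ℤ → b ≡ e × c ≢ 0ℤ
coeff-singleton c b e nz with b ≟ᴿ e
... | yes refl = refl , λ { refl → nz (coeff-∷-≡ 0ℤ b []) }
... | no b≢e   = contradiction (coeff-∷-≢ c [] b≢e) nz

coeff⇒Br : ∀ (b c e : Raw n) → brCoeff e b c ≢ 0ℤ → Br b c e
coeff⇒Br (mon k Λ) (mon j Θ) e nz with ℕ.<-cmp (toℕ j) (toℕ k)
... | tri≈ _ _ _ = contradiction refl nz
... | tri< j<k _ _ with coeff-singleton (+ lookup Λ j) (mon k (zipWith ℕ._+_ (decr Λ j) Θ)) e nz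
...   | refl , c≢0 = down j<k (c≢0 ∘ cong +_)
coeff⇒Br (mon k Λ) (mon j Θ) e nz | tri> _ _ k<j
  with coeff-singleton (ℤ.- (+ lookup Θ k)) (mon j (zipWith ℕ._+_ Λ (decr Θ k))) e nz
...   | refl , c≢0 = up k<j (c≢0 ∘ cong (λ m → ℤ.- (+ m)))

Br⇒coeff : ∀ {b c e : Raw n} → Br b c e → brCoeff e b c ≢ 0ℤ
Br⇒coeff {b = mon k Λ} {mon j Θ} (down j<k λ≢0) with ℕ.<-cmp (toℕ j) (toℕ k)
... | tri< _ _ _   = λ z → λ≢0 (ℤ.+-injective
        (trans (sym (trans (coeff-∷-≡ (+ lookup Λ j) (mon k (zipWith ℕ._+_ (decr Λ j) Θ)) []) (ℤ.+-identityʳ _))) z))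
... | tri≈ j≮k _ _ = contradiction j<k j≮k
... | tri> j≮k _ _ = contradiction j<k j≮k
Br⇒coeff {b = mon k Λ} {mon j Θ} (up k<j θ≢0) with ℕ.<-cmp (toℕ j) (toℕ k)
... | tri< _ _ k≮j = contradiction k<j k≮j
... | tri≈ _ _ k≮j = contradiction k<j k≮j
... | tri> _ _ _   = λ z → θ≢0 (ℤ.+-injective (ℤ.neg-injective {j = 0ℤ}
        (trans (sym (trans (coeff-∷-≡ (ℤ.- (+ lookup Θ k)) (mon j (zipWith ℕ._+_ Λ (decr Θ k))) []) (ℤ.+-identityʳ _))) z)))

zipWith-+-cancelˡ : ∀ {m} (Λ Θ Θ′ : Vec ℕ m) → zipWith ℕ._+_ Λ Θ ≡ zipWith ℕ._+_ Λ Θ′ → Θ ≡ Θ′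
zipWith-+-cancelˡ []      []      []        _  = refl
zipWith-+-cancelˡ (a ∷ Λ) (x ∷ Θ) (x′ ∷ Θ′) eq =
  cong₂ _∷_ (ℕ.+-cancelˡ-≡ a x x′ (Vec.∷-injectiveˡ eq)) (zipWith-+-cancelˡ Λ Θ Θ′ (Vec.∷-injectiveʳ eq))

zipWith-+-cancelʳ : ∀ {m} (Λ Λ′ Θ : Vec ℕ m) → zipWith ℕ._+_ Λ Θ ≡ zipWith ℕ._+_ Λ′ Θ → Λ ≡ Λ′
zipWith-+-cancelʳ Λ Λ′ Θ eq = zipWith-+-cancelˡ Θ Λ Λ′
  (trans (Vec.zipWith-comm ℕ.+-comm Θ Λ) (trans eq (Vec.zipWith-comm ℕ.+-comm Λ′ Θ)))

decr-injective : ∀ {m} (Λ Λ′ : Vec ℕ m) t → lookup Λ t ≢ 0 → lookup Λ′ t ≢ 0 →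
  decr Λ t ≡ decr Λ′ t → Λ ≡ Λ′
decr-injective (zero ∷ _)  _             Fin.zero    nz _   _  = contradiction refl nz
decr-injective (suc _ ∷ _) (zero ∷ _)    Fin.zero    _  nz′ _  = contradiction refl nz′
decr-injective (suc _ ∷ _) (suc _ ∷ _)   Fin.zero    _  _   eq =
  cong₂ _∷_ (cong suc (Vec.∷-injectiveˡ eq)) (Vec.∷-injectiveʳ eq)
decr-injective (_ ∷ Λ)     (_ ∷ Λ′)      (Fin.suc t) nz nz′ eq =
  cong₂ _∷_ (Vec.∷-injectiveˡ eq) (decr-injective Λ Λ′ t nz nz′ (Vec.∷-injectiveʳ eq))

mon-injectiveʳ : ∀ {k j : Fin n} {Λ Θ} → mon k Λ ≡ mon j Θ → Λ ≡ Θ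
mon-injectiveʳ refl = refl

lookup-zipWith-decr : ∀ (Λ Θ : Vec ℕ n) k t →
  lookup (zipWith ℕ._+_ Λ (decr Θ k)) t ≡ lookup Λ t ℕ.+ lookup (decr Θ k) t
lookup-zipWith-decr Λ Θ k t = Vec.lookup-zipWith ℕ._+_ t Λ (decr Θ k)

-- If Λ - e_k = Λ′ - e_k′ up to the common summand Θ, comparing the exponents of x_k′ rules out k < k′.
up-≮ : ∀ {k k′ : Fin n} {Λ Λ′ Θ} → InB (mon k Λ) → InB (mon k′ Λ′) → lookup Θ k′ ≢ 0 →
  zipWith ℕ._+_ Λ (decr Θ k) ≡ zipWith ℕ._+_ Λ′ (decr Θ k′) → ¬ toℕ k ℕ.< toℕ k′
up-≮ {k = k} {k′} {Λ} {Λ′} {Θ} Λ∈ Λ′∈ θ≢0 eq k<k′ = pred-≢ _ θ≢0 (begin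
  lookup Θ k′                                ≡⟨ Vec.lookup∘updateAt′ k′ k k′≢k Θ ⟨
  lookup (decr Θ k) k′                       ≡⟨ cong (ℕ._+ lookup (decr Θ k) k′) (Λ∈ k′ (ℕ.<⇒≤ k<k′)) ⟨
  lookup Λ k′ ℕ.+ lookup (decr Θ k) k′        ≡⟨ lookup-zipWith-decr Λ Θ k k′ ⟨
  lookup (zipWith ℕ._+_ Λ (decr Θ k)) k′      ≡⟨ cong (λ v → lookup v k′) eq ⟩
  lookup (zipWith ℕ._+_ Λ′ (decr Θ k′)) k′    ≡⟨ lookup-zipWith-decr Λ′ Θ k′ k′ ⟩
  lookup Λ′ k′ ℕ.+ lookup (decr Θ k′) k′      ≡⟨ cong₂ ℕ._+_ (Λ′∈ k′ ℕ.≤-refl) (Vec.lookup∘updateAt k′ Θ) ⟩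
  ℕ.pred (lookup Θ k′)                       ∎)
  where
  open ≡-Reasoning
  k′≢k : k′ ≢ k
  k′≢k refl = ℕ.<-irrefl refl k<k′
  pred-≢ : ∀ m → m ≢ 0 → m ≢ ℕ.pred m
  pred-≢ zero    m≢0 _ = m≢0 refl
  pred-≢ (suc m) _     = ℕ.1+n≢n

-- The derivation of `e` reveals the rule: it lies strictly above that of `c` for `down` and equals
-- it for `up`. Within one rule the exponents cancel, once `up-≮` in both directions has forced
-- equal derivations in the case of `up`.
Br-injective : ∀ {b b′ c e : Raw n} → InB b → InB b′ → Br b c e → Br b′ c e → b ≡ b′
Br-injective {b = mon k Λ} {mon k′ Λ′} {mon j Θ} b∈ b′∈ p q = go p q refl
  where
  -- The two targets are kept apart and joined by an equation, since unifying their `zipWith`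
  -- expressions would get stuck.
  go : ∀ {e e′} → Br (mon k Λ) (mon j Θ) e → Br (mon k′ Λ′) (mon j Θ) e′ → e ≡ e′ →
       mon k Λ ≡ mon k′ Λ′
  go (down _ nz)  (down _ nz′)  eq with cong dk eq
  ... | refl = cong (mon k) (decr-injective Λ Λ′ j nz nz′ (zipWith-+-cancelʳ _ _ Θ (mon-injectiveʳ eq)))
  go (down j<k _) (up _ _)      eq = contradiction (cong (toℕ ∘ dk) (sym eq)) (ℕ.<⇒≢ j<k)
  go (up _ _)     (down j<k′ _) eq = contradiction (cong (toℕ ∘ dk) eq) (ℕ.<⇒≢ j<k′)
  go (up _ nz)    (up _ nz′)    eq with ℕ.<-cmp (toℕ k) (toℕ k′)
  ... | tri< k<k′ _ _ = contradiction k<k′ (up-≮ {Λ = Λ} {Λ′} b∈ b′∈ nz′ (mon-injectiveʳ eq))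
  ... | tri> _ _ k′<k = contradiction k′<k (up-≮ {Λ = Λ′} {Λ} b′∈ b∈ nz (mon-injectiveʳ (sym eq)))
  ... | tri≈ _ k≡k′ _ with Fin.toℕ-injective k≡k′
  ...   | refl = cong (mon k) (zipWith-+-cancelʳ Λ Λ′ _ (mon-injectiveʳ eq))

-- Closure of 𝓑 under the bracket

Elt-concatMap : ∀ (f : ℤ × Raw n → FSum n) → (∀ c b → InB b → Elt (f (c , b))) →
  ∀ y → Elt y → Elt (concatMap f y)
Elt-concatMap f f∈ []            []        = []
Elt-concatMap f f∈ ((c , b) ∷ y) (b∈ ∷ y∈) = All.++⁺ (f∈ c b b∈) (Elt-concatMap f f∈ y y∈)

Elt-scale : ∀ c (y : FSum n) → Elt y → Elt (scale c y)
Elt-scale c []      []        = []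
Elt-scale c (_ ∷ y) (b∈ ∷ y∈) = b∈ ∷ Elt-scale c y y∈

lookup-zipWith-0 : ∀ (Λ Θ : Vec ℕ n) t → lookup Λ t ≡ 0 → lookup Θ t ≡ 0 →
  lookup (zipWith ℕ._+_ Λ Θ) t ≡ 0
lookup-zipWith-0 Λ Θ t Λt Θt = trans (Vec.lookup-zipWith ℕ._+_ t Λ Θ) (cong₂ ℕ._+_ Λt Θt)

lookup-decr-0 : ∀ (Λ : Vec ℕ n) j t → lookup Λ t ≡ 0 → lookup (decr Λ j) t ≡ 0
lookup-decr-0 Λ j t Λt with t Fin.≟ j
... | yes refl = trans (Vec.lookup∘updateAt t Λ) (cong ℕ.pred Λt)
... | no t≢j   = trans (Vec.lookup∘updateAt′ t j t≢j Λ) Λt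

Elt-brB : ∀ (b c : Raw n) → InB b → InB c → Elt (brB b c)
Elt-brB (mon k Λ) (mon j Θ) b∈ c∈ with ℕ.<-cmp (toℕ j) (toℕ k)
... | tri≈ _ _ _   = []
... | tri< j<k _ _ = (λ t k≤t → lookup-zipWith-0 (decr Λ j) Θ t
        (lookup-decr-0 Λ j t (b∈ t k≤t)) (c∈ t (ℕ.≤-trans (ℕ.<⇒≤ j<k) k≤t))) ∷ []
... | tri> _ _ k<j = (λ t j≤t → lookup-zipWith-0 Λ (decr Θ k) t
        (b∈ t (ℕ.≤-trans (ℕ.<⇒≤ k<j) j≤t)) (lookup-decr-0 Θ k t (c∈ t j≤t))) ∷ []

Elt-br : ∀ (y z : FSum n) → Elt y → Elt z → Elt (br y z)
Elt-br y z y∈ z∈ = Elt-concatMap _ (λ c b b∈ →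
  Elt-concatMap _ (λ d b′ b′∈ → Elt-scale (c ℤ.* d) (brB b b′) (Elt-brB b b′ b∈ b′∈)) z z∈) y y∈

Elt⇒SupportedOn : ∀ (y : FSum n) → Elt y → SupportedOn InB y
Elt⇒SupportedOn y y∈ = All⇒SupportedOn y (All.map id y∈)

Br-InB : ∀ {b c e : Raw n} → InB b → InB c → Br b c e → InB e
Br-InB {b = b} {c} {e} b∈ c∈ p = Elt⇒SupportedOn (brB b c) (Elt-brB b c b∈ c∈) e (Br⇒coeff p)

-- Weighted exponent sums, and additivity of gap and degree

wsum : (Fin n → ℕ) → Vec ℕ n → ℕ
wsum f Λ = Vec.sum (zipWith ℕ._*_ (tabulate f) Λ)

wsum-+ : ∀ f (Λ Θ : Vec ℕ n) → wsum f (zipWith ℕ._+_ Λ Θ) ≡ wsum f Λ ℕ.+ wsum f Θ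
wsum-+ f []      []      = refl
wsum-+ f (x ∷ Λ) (y ∷ Θ) rewrite wsum-+ (f ∘ Fin.suc) Λ Θ = rearrange (f Fin.zero) x y _ _
  where
  rearrange : ∀ a x y s t → a ℕ.* (x ℕ.+ y) ℕ.+ (s ℕ.+ t) ≡ a ℕ.* x ℕ.+ s ℕ.+ (a ℕ.* y ℕ.+ t)
  rearrange = ℕSolver.solve-∀

wsum-decr : ∀ f (Λ : Vec ℕ n) t → lookup Λ t ≢ 0 → f t ℕ.+ wsum f (decr Λ t) ≡ wsum f Λ
wsum-decr f (zero ∷ Λ)  Fin.zero    nz = contradiction refl nz
wsum-decr f (suc x ∷ Λ) Fin.zero    nz = peel (f Fin.zero) x _
  where
  peel : ∀ a x s → a ℕ.+ (a ℕ.* x ℕ.+ s) ≡ a ℕ.* suc x ℕ.+ s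
  peel = ℕSolver.solve-∀
wsum-decr f (x ∷ Λ)     (Fin.suc t) nz rewrite sym (wsum-decr (f ∘ Fin.suc) Λ t nz) =
  swap (f (Fin.suc t)) (f Fin.zero ℕ.* x) _
  where
  swap : ∀ a b c → a ℕ.+ (b ℕ.+ c) ≡ b ℕ.+ (a ℕ.+ c)
  swap = ℕSolver.solve-∀

wsum-1 : ∀ (Λ : Vec ℕ n) → wsum (const 1) Λ ≡ deg Λ
wsum-1 []      = refl
wsum-1 (x ∷ Λ) = cong₂ ℕ._+_ (ℕ.*-identityˡ x) (wsum-1 Λ)

-- For `f = toℕ` the left side is `wt Λ`, so `wt Λ - deg Λ` is the sum of the (t - 1) λ_t, which is
-- what `gap` subtracts.
wsum-suc : ∀ f (Λ : Vec ℕ n) → wsum (suc ∘ f) Λ ≡ wsum f Λ ℕ.+ deg Λ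
wsum-suc f []      = refl
wsum-suc f (x ∷ Λ) rewrite wsum-suc (f ∘ Fin.suc) Λ = rearrange (f Fin.zero) x _ _
  where
  rearrange : ∀ a x s t → suc a ℕ.* x ℕ.+ (s ℕ.+ t) ≡ a ℕ.* x ℕ.+ s ℕ.+ (x ℕ.+ t)
  rearrange = ℕSolver.solve-∀

wsum-≤ : ∀ k f (Λ : Vec ℕ n) → (∀ t → lookup Λ t ≢ 0 → f t ℕ.≤ k) → wsum f Λ ℕ.≤ k ℕ.* deg Λ
wsum-≤ k f []      f≤k = z≤n
wsum-≤ k f (x ∷ Λ) f≤k = subst (wsum f (x ∷ Λ) ℕ.≤_) (sym (ℕ.*-distribˡ-+ k x (deg Λ)))
  (ℕ.+-mono-≤ (head x (f≤k Fin.zero)) (wsum-≤ k (f ∘ Fin.suc) Λ (f≤k ∘ Fin.suc)))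
  where
  head : ∀ x → (x ≢ 0 → f Fin.zero ℕ.≤ k) → f Fin.zero ℕ.* x ℕ.≤ k ℕ.* x
  head zero    _ = ℕ.≤-reflexive (trans (ℕ.*-zeroʳ (f Fin.zero)) (sym (ℕ.*-zeroʳ k)))
  head (suc x) h = ℕ.*-monoˡ-≤ (suc x) (h λ ())

-- With n - 1 = D, this is D - WD(b); unlike WD it is additive on brackets.
gap : Raw n → ℤ
gap b = + toℕ (dk b) ℤ.- + wsum toℕ (exp b)

rdeg : Raw n → ℤ
rdeg b = + deg (exp b) ℤ.- 1ℤ

-- The variable that is differentiated away carries the same index as the derivation that
-- disappears, so their two contributions cancel.
Br-gap : ∀ {b c e : Raw n} → Br b c e → gap e ≡ gap b ℤ.+ gap c
Br-gap (down {k} {j} {Λ} {Θ} _ nz)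
  rewrite wsum-+ toℕ (decr Λ j) Θ | sym (wsum-decr toℕ Λ j nz)
        | ℤ.pos-+ (wsum toℕ (decr Λ j)) (wsum toℕ Θ) | ℤ.pos-+ (toℕ j) (wsum toℕ (decr Λ j))
  = identity (+ toℕ k) (+ toℕ j) (+ wsum toℕ (decr Λ j)) (+ wsum toℕ Θ)
  where
  identity : ∀ k j v w → k ℤ.- (v ℤ.+ w) ≡ k ℤ.- (j ℤ.+ v) ℤ.+ (j ℤ.- w)
  identity = solve-∀
Br-gap (up {k} {j} {Λ} {Θ} _ nz)
  rewrite wsum-+ toℕ Λ (decr Θ k) | sym (wsum-decr toℕ Θ k nz)
        | ℤ.pos-+ (wsum toℕ Λ) (wsum toℕ (decr Θ k)) | ℤ.pos-+ (toℕ k) (wsum toℕ (decr Θ k))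
  = identity (+ toℕ k) (+ toℕ j) (+ wsum toℕ Λ) (+ wsum toℕ (decr Θ k))
  where
  identity : ∀ k j v w → j ℤ.- (v ℤ.+ w) ≡ k ℤ.- v ℤ.+ (j ℤ.- (k ℤ.+ w))
  identity = solve-∀

deg-+-decr : ∀ (Λ Θ : Vec ℕ n) t → lookup Θ t ≢ 0 →
  suc (deg (zipWith ℕ._+_ Λ (decr Θ t))) ≡ deg Λ ℕ.+ deg Θ
deg-+-decr Λ Θ t nz = begin
  suc (deg (zipWith ℕ._+_ Λ (decr Θ t)))             ≡⟨ cong suc (wsum-1 (zipWith ℕ._+_ Λ (decr Θ t))) ⟨
  suc (wsum one (zipWith ℕ._+_ Λ (decr Θ t)))        ≡⟨ cong suc (wsum-+ one Λ (decr Θ t)) ⟩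
  suc (wsum one Λ ℕ.+ wsum one (decr Θ t))           ≡⟨ ℕ.+-suc (wsum one Λ) _ ⟨
  wsum one Λ ℕ.+ suc (wsum one (decr Θ t))           ≡⟨ cong (wsum one Λ ℕ.+_) (wsum-decr one Θ t nz) ⟩
  wsum one Λ ℕ.+ wsum one Θ                          ≡⟨ cong₂ ℕ._+_ (wsum-1 Λ) (wsum-1 Θ) ⟩
  deg Λ ℕ.+ deg Θ                                    ∎
  where
  open ≡-Reasoning
  one : Fin _ → ℕ
  one = const 1

Br-deg : ∀ {b c e : Raw n} → Br b c e → suc (deg (exp e)) ≡ deg (exp b) ℕ.+ deg (exp c)
Br-deg (down {k} {j} {Λ} {Θ} _ nz) = trans
  (cong (suc ∘ deg) (Vec.zipWith-comm ℕ.+-comm (decr Λ j) Θ))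
  (trans (deg-+-decr Θ Λ j nz) (ℕ.+-comm (deg Θ) (deg Λ)))
Br-deg (up {k} {j} {Λ} {Θ} _ nz) = deg-+-decr Λ Θ k nz

Br-rdeg : ∀ {b c e : Raw n} → Br b c e → rdeg e ≡ rdeg b ℤ.+ rdeg c
-- `rdeg e` is definitionally `+ suc (deg (exp e)) - 1 - 1`, the form to which `Br-deg` applies.
Br-rdeg {b = b} {c} {e} p = trans (cong (λ m → + m ℤ.- 1ℤ ℤ.- 1ℤ) (Br-deg p))
  (trans (cong (λ x → x ℤ.- 1ℤ ℤ.- 1ℤ) (ℤ.pos-+ (deg (exp b)) (deg (exp c)))) (identity (+ deg (exp b)) (+ deg (exp c))))
  where
  identity : ∀ x y → x ℤ.+ y ℤ.- 1ℤ ℤ.- 1ℤ ≡ x ℤ.- 1ℤ ℤ.+ (y ℤ.- 1ℤ)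
  identity = solve-∀

-- The inequalities defining 𝒩

-- The pattern of the linear arithmetic below: hypotheses are added up to `i ≤ j`, and the ring
-- solver confirms that the target has the same slack.
≤-shift : ∀ {i j x y} → i ℤ.≤ j → j ℤ.- i ≡ y ℤ.- x → x ℤ.≤ y
≤-shift i≤j eq = ℤ.0≤i-j⇒j≤i (subst (0ℤ ℤ.≤_) eq (ℤ.i≤j⇒0≤j-i i≤j))

-- What membership in 𝓑 yields about gap and reduced degree: the alternatives are the pure
-- derivations, the symbols of degree one, and those of degree at least two, whose gap may be
-- negative.
Admissible : ℤ → ℤ → Set
Admissible u d = (d ≡ ℤ.-1ℤ × 0ℤ ℤ.≤ u) ⊎ (d ≡ 0ℤ × 1ℤ ℤ.≤ u) ⊎ 1ℤ ℤ.≤ d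

-- A derivation has d + 1 = 0 ≤ hu, degree one has u ≥ 1, and 1 ≤ d ≤ hu forces u ≥ 1. The resulting
-- unit of slack pays for the drop from `suc r` to `r` in `Level-+`.
admissible-slope : ∀ h {u d} → Admissible u d → d ℤ.≤ + h ℤ.* u →
  0ℤ ℤ.≤ u × (1ℤ ℤ.≤ u ⊎ d ℤ.+ 1ℤ ℤ.≤ + h ℤ.* u)
admissible-slope h {u} (inj₁ (refl , 0≤u)) _ =
  0≤u , inj₂ (subst (ℤ._≤ + h ℤ.* u) (ℤ.*-zeroʳ (+ h)) (ℤ.*-monoˡ-≤-nonNeg (+ h) 0≤u))
admissible-slope h (inj₂ (inj₁ (_ , 1≤u))) _ = ℤ.≤-trans (ℤ.+≤+ z≤n) 1≤u , inj₁ 1≤u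
admissible-slope h {u} (inj₂ (inj₂ 1≤d)) d≤hu = ℤ.≤-trans (ℤ.+≤+ z≤n) 1≤u , inj₁ 1≤u
  where
  1≤u : 1ℤ ℤ.≤ u
  1≤u with 1ℤ ℤ.≤? u
  ... | yes p = p
  ... | no ¬p = contradiction
    (ℤ.≤-trans 1≤d (ℤ.≤-trans d≤hu
      (subst (+ h ℤ.* u ℤ.≤_) (ℤ.*-zeroʳ (+ h)) (ℤ.*-monoˡ-≤-nonNeg (+ h) (ℤ.i<j⇒i≤pred[j] (ℤ.≰⇒> ¬p))))))
    λ { (ℤ.+≤+ ()) }

-- Membership of a symbol with gap u and reduced degree d in 𝒩_i, for i = r + hD with 0 ≤ r ≤ D.
-- The two descriptions of a multiple of D agree by Level-wrap and Level-unwrap.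
Level : (D h r : ℕ) → ℤ → ℤ → Set
Level D h r u d = d ℤ.≤ + h ℤ.* u ⊎ d ℤ.+ + D ℤ.≤ + suc h ℤ.* u ℤ.+ + r

Level-suc : ∀ {D} h {r u d} → Level D h r u d → Level D h (suc r) u d
Level-suc h (inj₁ p) = inj₁ p
Level-suc h {r} {u} (inj₂ p) =
  inj₂ (ℤ.≤-trans p (ℤ.+-monoʳ-≤ (+ suc h ℤ.* u) (ℤ.+≤+ (ℕ.n≤1+n r))))

-- At `r = D` the second alternative reads d ≤ (h + 1)u, and d ≤ hu implies it because u ≥ 0.
Level-wrap : ∀ {D} h {u d} → Admissible u d → Level D h D u d → Level D (suc h) 0 u d
Level-wrap h {u} {d} ad (inj₁ p) =
  inj₁ (≤-shift (ℤ.+-mono-≤ p (proj₁ (admissible-slope h ad p))) (identity (+ h) u d))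
  where
  identity : ∀ h u d → h ℤ.* u ℤ.+ u ℤ.- (d ℤ.+ 0ℤ) ≡ (1ℤ ℤ.+ h) ℤ.* u ℤ.- d
  identity = solve-∀
Level-wrap {D} h {u} {d} ad (inj₂ p) = inj₁ (≤-shift p (identity (+ suc h ℤ.* u) (+ D) d))
  where
  identity : ∀ v D d → v ℤ.+ D ℤ.- (d ℤ.+ D) ≡ v ℤ.- d
  identity = solve-∀

-- Here d ≤ (h + 1)u is the second alternative at `r = D`, and d + D ≤ (h + 2)u reduces to it
-- because u ≤ D.
Level-unwrap : ∀ {D} h {u d} → u ℤ.≤ + D → Level D (suc h) 0 u d → Level D h D u d
Level-unwrap {D} h {u} {d} u≤D (inj₁ p) = inj₂ (ℤ.+-monoˡ-≤ (+ D) p)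
Level-unwrap {D} h {u} {d} u≤D (inj₂ p) =
  inj₂ (≤-shift (ℤ.+-mono-≤ p u≤D) (identity (+ suc h) u d (+ D)))
  where
  identity : ∀ h u d D → (1ℤ ℤ.+ h) ℤ.* u ℤ.+ 0ℤ ℤ.+ D ℤ.- (d ℤ.+ D ℤ.+ u) ≡ h ℤ.* u ℤ.+ D ℤ.- (d ℤ.+ D)
  identity = solve-∀

Level-+ : ∀ {D} h r {u d u′ d′} → r ℕ.< D → Admissible u d → Admissible u′ d′ →
  Level D h (suc r) u d → Level D h r u′ d′ → Level D h r (u ℤ.+ u′) (d ℤ.+ d′)
Level-+ h r {u} {d} {u′} {d′} _ _ _ (inj₁ p) (inj₁ q) =
  inj₁ (≤-shift (ℤ.+-mono-≤ p q) (identity (+ h) u d u′ d′))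
  where
  identity : ∀ h u d u′ d′ → h ℤ.* u ℤ.+ h ℤ.* u′ ℤ.- (d ℤ.+ d′) ≡ h ℤ.* (u ℤ.+ u′) ℤ.- (d ℤ.+ d′)
  identity = solve-∀
-- The missing summand u on the right is supplied by 0 ≤ u.
Level-+ {D} h r {u} {d} {u′} {d′} _ ad _ (inj₁ p) (inj₂ q) =
  inj₂ (≤-shift (ℤ.+-mono-≤ (ℤ.+-mono-≤ p q) (proj₁ (admissible-slope h ad p))) (identity (+ h) (+ r) (+ D) u d u′ d′))
  where
  identity : ∀ h r D u d u′ d′ →
    h ℤ.* u ℤ.+ ((1ℤ ℤ.+ h) ℤ.* u′ ℤ.+ r) ℤ.+ u ℤ.- (d ℤ.+ (d′ ℤ.+ D) ℤ.+ 0ℤ) ≡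
    (1ℤ ℤ.+ h) ℤ.* (u ℤ.+ u′) ℤ.+ r ℤ.- (d ℤ.+ d′ ℤ.+ D)
  identity = solve-∀
-- The sum falls short by u′ - 1: either u′ ≥ 1, or the second inequality has a unit to spare and u′
-- ≥ 0.
Level-+ {D} h r {u} {d} {u′} {d′} _ _ ad′ (inj₂ p) (inj₁ q) with admissible-slope h ad′ q
... | _ , inj₁ 1≤u′ =
  inj₂ (≤-shift (ℤ.+-mono-≤ (ℤ.+-mono-≤ p q) 1≤u′) (identity (+ h) (+ r) (+ D) u d u′ d′))
  where
  identity : ∀ h r D u d u′ d′ →
    (1ℤ ℤ.+ h) ℤ.* u ℤ.+ (1ℤ ℤ.+ r) ℤ.+ h ℤ.* u′ ℤ.+ u′ ℤ.- (d ℤ.+ D ℤ.+ d′ ℤ.+ 1ℤ) ≡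
    (1ℤ ℤ.+ h) ℤ.* (u ℤ.+ u′) ℤ.+ r ℤ.- (d ℤ.+ d′ ℤ.+ D)
  identity = solve-∀
... | 0≤u′ , inj₂ q′ =
  inj₂ (≤-shift (ℤ.+-mono-≤ (ℤ.+-mono-≤ p q′) 0≤u′) (identity (+ h) (+ r) (+ D) u d u′ d′))
  where
  identity : ∀ h r D u d u′ d′ →
    (1ℤ ℤ.+ h) ℤ.* u ℤ.+ (1ℤ ℤ.+ r) ℤ.+ h ℤ.* u′ ℤ.+ u′ ℤ.- (d ℤ.+ D ℤ.+ (d′ ℤ.+ 1ℤ) ℤ.+ 0ℤ) ≡
    (1ℤ ℤ.+ h) ℤ.* (u ℤ.+ u′) ℤ.+ r ℤ.- (d ℤ.+ d′ ℤ.+ D)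
  identity = solve-∀
-- The sum has D twice on the left and 2r + 1 on the right; r + 1 ≤ D removes the surplus.
Level-+ {D} h r {u} {d} {u′} {d′} r<D _ _ (inj₂ p) (inj₂ q) =
  inj₂ (≤-shift (ℤ.+-mono-≤ (ℤ.+-mono-≤ p q) (ℤ.+≤+ r<D)) (identity (+ h) (+ r) (+ D) u d u′ d′))
  where
  identity : ∀ h r D u d u′ d′ →
    (1ℤ ℤ.+ h) ℤ.* u ℤ.+ (1ℤ ℤ.+ r) ℤ.+ ((1ℤ ℤ.+ h) ℤ.* u′ ℤ.+ r) ℤ.+ D
      ℤ.- (d ℤ.+ D ℤ.+ (d′ ℤ.+ D) ℤ.+ (1ℤ ℤ.+ r)) ≡
    (1ℤ ℤ.+ h) ℤ.* (u ℤ.+ u′) ℤ.+ r ℤ.- (d ℤ.+ d′ ℤ.+ D)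
  identity = solve-∀

-- A test element with u = 1 and d = h lies on the line d = hu, so the first alternative is
-- unchanged; in the second, (h + 1) - h = 1 raises `r` by one.
Level-probe : ∀ {D} h r {u d} → Level D h r (u ℤ.+ 1ℤ) (d ℤ.+ + h) → Level D h (suc r) u d
Level-probe h r {u} {d} (inj₁ p) = inj₁ (≤-shift p (identity (+ h) u d))
  where
  identity : ∀ h u d → h ℤ.* (u ℤ.+ 1ℤ) ℤ.- (d ℤ.+ h) ≡ h ℤ.* u ℤ.- d
  identity = solve-∀
Level-probe {D} h r {u} {d} (inj₂ p) = inj₂ (≤-shift p (identity (+ h) (+ r) (+ D) u d))
  where
  identity : ∀ h r D u d →
    (1ℤ ℤ.+ h) ℤ.* (u ℤ.+ 1ℤ) ℤ.+ r ℤ.- (d ℤ.+ h ℤ.+ D) ≡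
    (1ℤ ℤ.+ h) ℤ.* u ℤ.+ (1ℤ ℤ.+ r) ℤ.- (d ℤ.+ D)
  identity = solve-∀

-- This serves x_1^m ∂_n, of gap `D`, tested with ∂_1, of gap 0 and reduced degree -1. From d - 1 ≤
-- hD follows d + D ≤ (h + 1)D + 1, so both alternatives land in the second.
Level-probe₁ : ∀ {D} h r {d} → Level D h r (+ D ℤ.+ 0ℤ) (d ℤ.- 1ℤ) → Level D h (suc r) (+ D) d
Level-probe₁ {D} h r {d} (inj₁ p) =
  inj₂ (≤-shift (ℤ.+-mono-≤ p (ℤ.+≤+ (z≤n {r}))) (identity (+ h) (+ r) (+ D) d))
  where
  identity : ∀ h r D d →
    h ℤ.* (D ℤ.+ 0ℤ) ℤ.+ r ℤ.- (d ℤ.- 1ℤ ℤ.+ 0ℤ) ≡ (1ℤ ℤ.+ h) ℤ.* D ℤ.+ (1ℤ ℤ.+ r) ℤ.- (d ℤ.+ D)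
  identity = solve-∀
Level-probe₁ {D} h r {d} (inj₂ p) = inj₂ (≤-shift p (identity (+ h) (+ r) (+ D) d))
  where
  identity : ∀ h r D d →
    (1ℤ ℤ.+ h) ℤ.* (D ℤ.+ 0ℤ) ℤ.+ r ℤ.- (d ℤ.- 1ℤ ℤ.+ D) ≡
    (1ℤ ℤ.+ h) ℤ.* D ℤ.+ (1ℤ ℤ.+ r) ℤ.- (d ℤ.+ D)
  identity = solve-∀

-- Bounds on gap and degree over 𝓑

InB⇒< : ∀ {b : Raw n} → InB b → ∀ t → lookup (exp b) t ≢ 0 → toℕ t ℕ.< toℕ (dk b)
InB⇒< {b = b} b∈ t nz = ℕ.≰⇒> λ k≤t → nz (b∈ t k≤t)

gap-0≤ : ∀ (b : Raw n) → wsum toℕ (exp b) ℕ.≤ toℕ (dk b) → 0ℤ ℤ.≤ gap b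
gap-0≤ b W≤k = ℤ.i≤j⇒0≤j-i (ℤ.+≤+ W≤k)

InB⇒Admissible : ∀ (b : Raw n) → InB b → Admissible (gap b) (rdeg b)
InB⇒Admissible (mon k Λ) b∈ = by-degree (deg Λ) refl
  where
  -- Every variable of the monomial has a smaller index than the derivation, so each factor
  -- contributes at most `toℕ k` after its weight is raised by one.
  W+deg≤ : wsum toℕ Λ ℕ.+ deg Λ ℕ.≤ toℕ k ℕ.* deg Λ
  W+deg≤ = subst (ℕ._≤ toℕ k ℕ.* deg Λ) (wsum-suc toℕ Λ)
    (wsum-≤ (toℕ k) (suc ∘ toℕ) Λ (InB⇒< {b = mon k Λ} b∈))
  by-degree : ∀ m → deg Λ ≡ m → Admissible (gap (mon k Λ)) (rdeg (mon k Λ))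
  by-degree zero eq = inj₁ (cong (λ m → + m ℤ.- 1ℤ) eq , gap-0≤ (mon k Λ)
    (ℕ.≤-trans (ℕ.m≤m+n _ _) (ℕ.≤-trans W+deg≤ (ℕ.≤-trans (ℕ.≤-reflexive
      (trans (cong (toℕ k ℕ.*_) eq) (ℕ.*-zeroʳ (toℕ k)))) z≤n))))
  by-degree (suc zero) eq = inj₂ (inj₁ (cong (λ m → + m ℤ.- 1ℤ) eq ,
    ≤-shift {i = + (wsum toℕ Λ ℕ.+ 1)} {+ toℕ k} (ℤ.+≤+ W+1≤k)
      (trans (cong (λ x → + toℕ k ℤ.- x) (ℤ.pos-+ (wsum toℕ Λ) 1)) (identity (+ toℕ k) (+ wsum toℕ Λ)))))
    where
    W+1≤k : wsum toℕ Λ ℕ.+ 1 ℕ.≤ toℕ k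
    W+1≤k = subst₂ ℕ._≤_ (cong (wsum toℕ Λ ℕ.+_) eq)
      (trans (cong (toℕ k ℕ.*_) eq) (ℕ.*-identityʳ (toℕ k))) W+deg≤
    identity : ∀ k w → k ℤ.- (w ℤ.+ 1ℤ) ≡ k ℤ.- w ℤ.- 1ℤ
    identity = solve-∀
  by-degree (suc (suc m)) eq = inj₂ (inj₂ (subst (λ m → 1ℤ ℤ.≤ + m ℤ.- 1ℤ) (sym eq) (ℤ.+≤+ (s≤s z≤n))))

gap≤ : ∀ {D} (b : Raw (suc D)) → gap b ℤ.≤ + D
gap≤ b = ℤ.≤-trans (ℤ.i-j≤i (+ toℕ (dk b)) (+ wsum toℕ (exp b))) (ℤ.+≤+ (Fin.toℕ≤pred[n] (dk b)))

-- Translating `lev` into `Level`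

WD≡ : ∀ {D} (b : Raw (suc D)) → WD b ≡ + D ℤ.- gap b
WD≡ {D} (mon k Λ) rewrite wsum-suc toℕ Λ | ℤ.pos-+ (wsum toℕ Λ) (deg Λ) =
  identity (+ wsum toℕ Λ) (+ deg Λ) (+ D) (+ toℕ k)
  where
  identity : ∀ w d D k → w ℤ.+ d ℤ.- d ℤ.+ (1ℤ ℤ.+ D) ℤ.- (1ℤ ℤ.+ k) ≡ D ℤ.- (k ℤ.- w)
  identity = solve-∀

lev≡ : ∀ {D} i (b : Raw (suc D)) → lev i b ≡ hh (suc D) i ℤ.* (+ D ℤ.- gap b) ℤ.+ rdeg b
lev≡ {D} i b rewrite WD≡ b = ℤ.+-assoc (hh (suc D) i ℤ.* (+ D ℤ.- gap b)) (+ deg (exp b)) (ℤ.- 1ℤ)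

hh-block : ∀ D h r → r ℕ.< suc D → hh (suc (suc D)) (+ (suc r ℕ.+ h ℕ.* suc D)) ≡ + suc h
hh-block D h r r<D = trans (cong (λ m → + m ℤ.+ 1ℤ) quotient) (cong +_ (ℕ.+-comm h 1))
  where
  quotient : (r ℕ.+ h ℕ.* suc D) ℕ./ suc D ≡ h
  quotient = trans (+-distrib-/-∣ʳ r (divides-refl h))
    (cong₂ ℕ._+_ (m<n⇒m/n≡0 r<D) (m*n/n≡m h (suc D)))

-- Floor division sends -1 to -1. The split on `D` lets the remainder of 1 reduce, which is 0 only
-- for divisor 1.
hh-0 : ∀ D → hh (suc (suc D)) 0ℤ ≡ 0ℤ
hh-0 zero    = refl
hh-0 (suc D) = refl

Reached : ∀ {n} → ℕ → Raw n → Set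
Reached m b = ∃ λ j′ → j′ ℕ.≤ m × lev (+ j′ ℤ.- + 1) b ℤ.≤ (+ j′ ℤ.- + 1)

Reached-suc⁻ : ∀ m (b : Raw n) → Reached (suc m) b → Reached m b ⊎ lev (+ m) b ℤ.≤ + m
Reached-suc⁻ m b (j′ , j′≤ , p) with ℕ.m≤n⇒m<n∨m≡n j′≤
... | inj₁ (s≤s j′≤m) = inj₁ (j′ , j′≤m , p)
... | inj₂ refl       = inj₂ p

Reached-suc⁺ : ∀ m (b : Raw n) → Reached m b ⊎ lev (+ m) b ℤ.≤ + m → Reached (suc m) b
Reached-suc⁺ m b (inj₁ (j′ , j′≤m , p)) = j′ , ℕ.m≤n⇒m≤1+n j′≤m , p
Reached-suc⁺ m b (inj₂ p)               = suc m , ℕ.≤-refl , p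

hh-₋₁ : ∀ D → hh (suc (suc (suc D))) ℤ.-1ℤ ≡ 0ℤ
hh-₋₁ zero    = refl
hh-₋₁ (suc D) = refl

lev-₋₁ : ∀ {D} (b : Raw (suc (suc (suc D)))) → lev ℤ.-1ℤ b ≡ rdeg b
lev-₋₁ {D} b = trans (lev≡ ℤ.-1ℤ b)
  (trans (cong (λ h → h ℤ.* (+ suc (suc D) ℤ.- gap b) ℤ.+ rdeg b) (hh-₋₁ D)) (ℤ.+-identityˡ (rdeg b)))

Reached-0⁻ : ∀ {D} (b : Raw (suc (suc D))) → InB b → Reached 0 b → rdeg b ℤ.≤ ℤ.-1ℤ
Reached-0⁻ {zero} b b∈ (zero , _ , p) = by-degree (InB⇒Admissible b b∈)
  where
  d≤-u : rdeg b ℤ.+ gap b ℤ.≤ 0ℤ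
  d≤-u = ≤-shift (subst (ℤ._≤ ℤ.-1ℤ) (lev≡ ℤ.-1ℤ b) p) (identity (gap b) (rdeg b))
    where
    identity : ∀ u d → ℤ.-1ℤ ℤ.- (ℤ.-1ℤ ℤ.* (1ℤ ℤ.- u) ℤ.+ d) ≡ 0ℤ ℤ.- (d ℤ.+ u)
    identity = solve-∀
  0≤u : 0ℤ ℤ.≤ gap b
  0≤u = gap-0≤ b (ℕ.≤-trans
    (wsum-≤ 0 toℕ (exp b) λ t nz → ℕ.≤-pred (ℕ.<-≤-trans (InB⇒< {b = b} b∈ t nz) (Fin.toℕ≤pred[n] (dk b))))
    z≤n)
  by-degree : Admissible (gap b) (rdeg b) → rdeg b ℤ.≤ ℤ.-1ℤ
  by-degree (inj₁ (d≡-1 , _))      = ℤ.≤-reflexive d≡-1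
  by-degree (inj₂ (inj₁ (d≡0 , 1≤u))) = contradiction
    (ℤ.≤-trans (ℤ.+-mono-≤ (ℤ.≤-reflexive (sym d≡0)) 1≤u) d≤-u) λ { (ℤ.+≤+ ()) }
  by-degree (inj₂ (inj₂ 1≤d))      = contradiction
    (ℤ.≤-trans (ℤ.+-mono-≤ 1≤d 0≤u) d≤-u) λ { (ℤ.+≤+ ()) }
Reached-0⁻ {suc D} b b∈ (zero , _ , p) =
  subst (ℤ._≤ ℤ.-1ℤ) (lev-₋₁ b) p

Reached-0⁺ : ∀ {D} (b : Raw (suc (suc D))) → rdeg b ℤ.≤ ℤ.-1ℤ → Reached 0 b
Reached-0⁺ {zero} b d≤-1 = 0 , z≤n , subst (ℤ._≤ ℤ.-1ℤ) (sym (lev≡ ℤ.-1ℤ b))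
  (≤-shift (ℤ.+-mono-≤ d≤-1 (gap≤ b)) (identity (gap b) (rdeg b)))
  where
  identity : ∀ u d → ℤ.-1ℤ ℤ.+ 1ℤ ℤ.- (d ℤ.+ u) ≡ ℤ.-1ℤ ℤ.- (ℤ.-1ℤ ℤ.* (1ℤ ℤ.- u) ℤ.+ d)
  identity = solve-∀
Reached-0⁺ {suc D} b d≤-1 = 0 , z≤n , subst (ℤ._≤ ℤ.-1ℤ) (sym (lev-₋₁ b)) d≤-1

lev-0 : ∀ {D} (b : Raw (suc (suc D))) → lev 0ℤ b ≡ rdeg b
lev-0 {D} b = trans (lev≡ 0ℤ b)
  (trans (cong (λ h → h ℤ.* (+ suc D ℤ.- gap b) ℤ.+ rdeg b) (hh-0 D)) (ℤ.+-identityˡ (rdeg b)))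

Reached-1⁻ : ∀ {D} (b : Raw (suc (suc D))) → InB b → Reached 1 b → rdeg b ℤ.≤ 0ℤ
Reached-1⁻ b b∈ r with Reached-suc⁻ 0 b r
... | inj₁ r₀ = ℤ.≤-trans (Reached-0⁻ b b∈ r₀) ℤ.-≤+
... | inj₂ p  = subst (ℤ._≤ 0ℤ) (lev-0 b) p

Reached-1⁺ : ∀ {D} (b : Raw (suc (suc D))) → rdeg b ℤ.≤ 0ℤ → Reached 1 b
Reached-1⁺ b d≤0 = Reached-suc⁺ 0 b (inj₂ (subst (ℤ._≤ 0ℤ) (sym (lev-0 b)) d≤0))

InLevel : ∀ {D} → (h r : ℕ) → Raw (suc D) → Set
InLevel {D} h r b = Level D h r (gap b) (rdeg b)

lev-block : ∀ {D} h r (b : Raw (suc (suc D))) → r ℕ.< suc D →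
  lev (+ (suc r ℕ.+ h ℕ.* suc D)) b ≡ + suc h ℤ.* (+ suc D ℤ.- gap b) ℤ.+ rdeg b
lev-block {D} h r b r<D = trans (lev≡ (+ (suc r ℕ.+ h ℕ.* suc D)) b)
  (cong (λ H → H ℤ.* (+ suc D ℤ.- gap b) ℤ.+ rdeg b) (hh-block D h r r<D))

pos-index : ∀ r h D → + (r ℕ.+ h ℕ.* D) ≡ + r ℤ.+ + h ℤ.* + D
pos-index r h D = trans (ℤ.pos-+ r (h ℕ.* D)) (cong (ℤ._+_ (+ r)) (ℤ.pos-* h D))

module _ {D : ℕ} (b : Raw (suc (suc D))) (b∈ : InB b) where

  -- The index of `Reached` is i + 1 for i = r + h(n - 1). When r ≥ 1, h_i = h + 1 and lev_i ≤ i
  -- rearranges to the second alternative of `Level`; earlier indices come from the induction.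
  Reached⇒Level : ∀ h r → r ℕ.≤ suc D → Reached (suc (r ℕ.+ h ℕ.* suc D)) b → InLevel h r b
  Reached⇒Level zero    zero    _   p = inj₁ (Reached-1⁻ b b∈ p)
  -- The start of block `suc h` and the end `r = suc D` of block `h` are definitionally the same
  -- index.
  Reached⇒Level (suc h) zero    _   p =
    Level-wrap h (InB⇒Admissible b b∈) (Reached⇒Level h (suc D) ℕ.≤-refl p)
  Reached⇒Level h       (suc r) r<D p with Reached-suc⁻ (suc r ℕ.+ h ℕ.* suc D) b p
  ... | inj₁ q = Level-suc h (Reached⇒Level h r (ℕ.<⇒≤ r<D) q)
  ... | inj₂ q = inj₂ (≤-shift (subst₂ ℤ._≤_ (lev-block h r b r<D) (pos-index (suc r) h (suc D)) q)
        (identity (+ h) (+ suc r) (+ suc D) (gap b) (rdeg b)))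
    where
    identity : ∀ h r D u d →
      r ℤ.+ h ℤ.* D ℤ.- ((1ℤ ℤ.+ h) ℤ.* (D ℤ.- u) ℤ.+ d) ≡ (1ℤ ℤ.+ h) ℤ.* u ℤ.+ r ℤ.- (d ℤ.+ D)
    identity = solve-∀

  Level⇒Reached : ∀ h r → r ℕ.≤ suc D → InLevel h r b → Reached (suc (r ℕ.+ h ℕ.* suc D)) b
  Level⇒Reached zero    zero    _   (inj₁ p) = Reached-1⁺ b p
  -- Here d + (n - 1) ≤ u and u ≤ n - 1, so d ≤ 0.
  Level⇒Reached zero    zero    _   (inj₂ p) = Reached-1⁺ b
    (≤-shift (ℤ.+-mono-≤ p (gap≤ b)) (identity (gap b) (rdeg b) (+ suc D)))
    where
    identity : ∀ u d D → 1ℤ ℤ.* u ℤ.+ 0ℤ ℤ.+ D ℤ.- (d ℤ.+ D ℤ.+ u) ≡ 0ℤ ℤ.- d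
    identity = solve-∀
  Level⇒Reached (suc h) zero    _   p =
    Level⇒Reached h (suc D) ℕ.≤-refl (Level-unwrap h (gap≤ b) p)
  -- The inequality d ≤ hu does not involve `r`, so it descends to the start of the block.
  Level⇒Reached h       (suc r) r<D (inj₁ p) =
    Reached-suc⁺ _ b (inj₁ (Level⇒Reached h r (ℕ.<⇒≤ r<D) (inj₁ p)))
  Level⇒Reached h       (suc r) r<D (inj₂ p) = Reached-suc⁺ _ b (inj₂
    (subst₂ ℤ._≤_ (sym (lev-block h r b r<D)) (sym (pos-index (suc r) h (suc D)))
      (≤-shift p (identity (+ h) (+ suc r) (+ suc D) (gap b) (rdeg b)))))
    where
    identity : ∀ h r D u d →
      (1ℤ ℤ.+ h) ℤ.* u ℤ.+ r ℤ.- (d ℤ.+ D) ≡ r ℤ.+ h ℤ.* D ℤ.- ((1ℤ ℤ.+ h) ℤ.* (D ℤ.- u) ℤ.+ d)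
    identity = solve-∀

-- Test elements

lookup-zeros : ∀ n (t : Fin n) → lookup (replicate n 0) t ≡ 0
lookup-zeros n t = Vec.lookup-replicate t 0

wsum-zeros : ∀ f → wsum {n} f (replicate n 0) ≡ 0
wsum-zeros {zero}  f = refl
wsum-zeros {suc n} f = cong₂ ℕ._+_ (ℕ.*-zeroʳ (f Fin.zero)) (wsum-zeros (f ∘ Fin.suc))

deg-zeros : ∀ n → deg (replicate n 0) ≡ 0
deg-zeros n = trans (sym (wsum-1 (replicate n 0))) (wsum-zeros {n} (const 1))

∂ : Fin n → Raw n
∂ {n} k = mon k (replicate n 0)

∂∈B : ∀ (k : Fin n) → InB (∂ k)
∂∈B {n} k t _ = lookup-zeros n t

rdeg-∂ : ∀ (k : Fin n) → rdeg (∂ k) ≡ ℤ.-1ℤ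
rdeg-∂ {n} k = cong (λ m → + m ℤ.- 1ℤ) (deg-zeros n)

incr : Vec ℕ n → Fin n → Vec ℕ n
incr Λ t = Vec.updateAt Λ t suc

lookup-incr≢0 : ∀ (Λ : Vec ℕ n) t → lookup (incr Λ t) t ≢ 0
lookup-incr≢0 Λ t eq = ℕ.1+n≢0 (trans (sym (Vec.lookup∘updateAt t Λ)) eq)

wsum-incr : ∀ f (Λ : Vec ℕ n) t → wsum f (incr Λ t) ≡ f t ℕ.+ wsum f Λ
wsum-incr f Λ t = trans (sym (wsum-decr f (incr Λ t) t (lookup-incr≢0 Λ t)))
  (cong (λ Θ → f t ℕ.+ wsum f Θ)
    (trans (Vec.updateAt-updateAt t Λ) (Vec.updateAt-id t Λ)))

-- x_1^h x_{q+1} ∂_{q+2} in the 1-based indexing of the paper.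
probe : ∀ {D} → ℕ → Fin (suc D) → Raw (suc (suc D))
probe {D} h q = mon (Fin.suc q) (incr (h ∷ replicate (suc D) 0) (Fin.inject₁ q))

probe∈B : ∀ {D} h (q : Fin (suc D)) → InB (probe h q)
probe∈B {D} h q (Fin.suc t) q<t = trans
  (Vec.lookup∘updateAt′ (Fin.suc t) (Fin.inject₁ q) t≢q (h ∷ replicate (suc D) 0))
  (lookup-zeros (suc D) t)
  where
  t≢q : Fin.suc t ≢ Fin.inject₁ q
  t≢q eq = ℕ.<-irrefl (trans (sym (Fin.toℕ-inject₁ q)) (cong toℕ (sym eq))) q<t

-- The variable x_1 has weight 0 in `gap`, so its exponent `h` adjusts the degree alone.
gap-probe : ∀ {D} h (q : Fin (suc D)) → gap (probe h q) ≡ 1ℤ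
gap-probe {D} h q = trans (cong (λ m → + suc (toℕ q) ℤ.- + m) W≡q) (identity (+ toℕ q))
  where
  W≡q : wsum toℕ (exp (probe h q)) ≡ toℕ q
  W≡q = trans (wsum-incr toℕ (h ∷ replicate (suc D) 0) (Fin.inject₁ q))
    (trans (cong₂ ℕ._+_ (Fin.toℕ-inject₁ q) (wsum-zeros {suc D} (suc ∘ toℕ))) (ℕ.+-identityʳ (toℕ q)))
  identity : ∀ q → 1ℤ ℤ.+ q ℤ.- q ≡ 1ℤ
  identity = solve-∀

rdeg-probe : ∀ {D} h (q : Fin (suc D)) → rdeg (probe h q) ≡ + h
rdeg-probe {D} h q = cong (λ m → + m ℤ.- 1ℤ) (begin
  deg (exp (probe h q))                                   ≡⟨ wsum-1 (exp (probe h q)) ⟨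
  wsum (const 1) (exp (probe h q))                        ≡⟨ wsum-incr (const 1) (h ∷ replicate (suc D) 0) (Fin.inject₁ q) ⟩
  suc (wsum (const 1) (h ∷ replicate (suc D) 0))          ≡⟨ cong suc (wsum-1 (h ∷ replicate (suc D) 0)) ⟩
  suc (h ℕ.+ deg (replicate (suc D) 0))                   ≡⟨ cong (λ m → suc (h ℕ.+ m)) (deg-zeros (suc D)) ⟩
  suc (h ℕ.+ 0)                                           ≡⟨ cong suc (ℕ.+-identityʳ h) ⟩
  suc h                                                   ∎)
  where open ≡-Reasoning

some-nonzero : ∀ (Λ : Vec ℕ n) → Λ ≡ replicate n 0 ⊎ ∃ λ t → lookup Λ t ≢ 0
some-nonzero []          = inj₁ refl
some-nonzero (suc _ ∷ Λ) = inj₂ (Fin.zero , λ ())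
some-nonzero (zero ∷ Λ) with some-nonzero Λ
... | inj₁ refl     = inj₁ refl
... | inj₂ (t , nz) = inj₂ (Fin.suc t , nz)

-- Idealizers of homogeneous spans

record IdealizesTo {n} (T S : Raw n → Set) : Set where
  field
    T⊆B   : ∀ {b} → T b → InB b
    S⊆B   : ∀ {b} → S b → InB b
    T?    : Decidable T
    S?    : Decidable S
    sound : ∀ {b c e} → T b → S c → Br b c e → S e
    full  : ∀ {b} → InB b → (∀ {c e} → S c → Br b c e → S e) → T b

module _ {S T U : Raw n → Set} (U? : Decidable U) where

  br-Span : (∀ {b c e} → S b → T c → Br b c e → U e) →
    ∀ {y z} → Span S y → Span T z → Span U (br y z)
  br-Span closed {y} {z} y∈ z∈ = SupportedOn⇒Span U? {br y z} λ e nz →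
    decidable-stable (U? e) λ ¬Ue → nz (trans (coeff-br y z e)
      (eval-vanishes _ y λ b y≢0 → eval-vanishes _ z λ c z≢0 →
        decidable-stable (brCoeff e b c ℤ.≟ 0ℤ) λ br≢0 → ¬Ue
          (closed (Span⇒SupportedOn {y = y} y∈ b y≢0) (Span⇒SupportedOn {y = z} z∈ c z≢0) (coeff⇒Br b c e br≢0))))

module _ {T S : Raw n → Set} (I : IdealizesTo T S) where
  open IdealizesTo I

  -- To recover membership, `y` is bracketed with a single symbol `c` of `S`. No cancellation can
  -- occur between distinct symbols of `y`, so `full` applies to each symbol in its support
  -- separately.
  Span≐Idealizer : Span T ≐ Idealizer (Span S)
  Span≐Idealizer y y∈B = mk⇔
    (λ y∈T z _ z∈S → br-Span S? sound {y} {z} y∈T z∈S)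
    λ idealizes → SupportedOn⇒Span T? {y} λ b y≢0 →
      full (Elt⇒SupportedOn y y∈B b y≢0) λ {c} {e} Sc b·c≈e →
        Span⇒SupportedOn {y = br y ((1ℤ , c) ∷ [])}
          (idealizes ((1ℤ , c) ∷ []) (S⊆B Sc ∷ []) ((1ℤ , c) ∷ [] , Sc ∷ [] , λ _ → refl)) e
          (coeff≢0 y≢0 (S⊆B Sc) b·c≈e)
    where
    coeff≢0 : ∀ {b c e} → coeff y b ≢ 0ℤ → InB c → Br b c e → coeff (br y ((1ℤ , c) ∷ [])) e ≢ 0ℤ
    coeff≢0 {b} {c} {e} y≢0 c∈B b·c≈e eq =
      [ y≢0 , Br⇒coeff b·c≈e ]′ (ℤ.i*j≡0⇒i≡0∨j≡0 (coeff y b) (begin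
        coeff y b ℤ.* brCoeff e b c              ≡⟨ cong (coeff y b ℤ.*_) (unit b) ⟨
        coeff y b ℤ.* F b                        ≡⟨ eval-concentrated F y b only-b ⟨
        eval F y                                 ≡⟨ coeff-br y ((1ℤ , c) ∷ []) e ⟨
        coeff (br y ((1ℤ , c) ∷ [])) e           ≡⟨ eq ⟩
        0ℤ                                       ∎))
      where
      open ≡-Reasoning
      F : Raw n → ℤ
      F b = eval (brCoeff e b) ((1ℤ , c) ∷ [])
      unit : ∀ b → F b ≡ brCoeff e b c
      unit b = trans (ℤ.+-identityʳ _) (ℤ.*-identityˡ (brCoeff e b c))
      -- By `Br-injective`, `b` is the only symbol in the support of `y` whose bracket with `c`
      -- reaches `e`.
      only-b : ∀ b′ → coeff y b′ ≢ 0ℤ → F b′ ≢ 0ℤ → b′ ≡ b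
      only-b b′ y≢0′ F≢0 = Br-injective (Elt⇒SupportedOn y y∈B b′ y≢0′) (Elt⇒SupportedOn y y∈B b y≢0)
        (coeff⇒Br b′ c e (F≢0 ∘ trans (unit b′))) b·c≈e

module _ {S : Raw n → Set} (S? : Decidable S) where

  Span-isLieSubring : (∀ {b c e} → S b → S c → Br b c e → S e) → IsLieSubring (Span S)
  Span-isLieSubring closed =
    ([] , [] , λ _ → refl) ,
    (λ { y z _ _ (y′ , Sy′ , y′≈y) (z′ , Sz′ , z′≈z) →
       y′ +L z′ , All.++⁺ Sy′ Sz′ ,
       λ b → trans (coeff-++ y′ z′ b) (trans (cong₂ ℤ._+_ (y′≈y b) (z′≈z b)) (sym (coeff-++ y z b))) }) ,
    (λ { y _ (y′ , Sy′ , y′≈y) →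
       -L y′ , All.map⁺ (All.map id Sy′) ,
       λ b → trans (coeff-neg y′ b) (trans (cong ℤ.-_ (y′≈y b)) (sym (coeff-neg y b))) }) ,
    λ y z _ _ y∈S z∈S → br-Span S? closed {y} {z} y∈S z∈S

≐-refl : ∀ {A : Pred𝔏 n} → A ≐ A
≐-refl y _ = mk⇔ id id

≐-trans : ∀ {A B C : Pred𝔏 n} → A ≐ B → B ≐ C → A ≐ C
≐-trans A≐B B≐C y y∈ = mk⇔
  (Equivalence.to (B≐C y y∈) ∘ Equivalence.to (A≐B y y∈))
  (Equivalence.from (A≐B y y∈) ∘ Equivalence.from (B≐C y y∈))

Span-cong : ∀ {S T : Raw n → Set} → (∀ {b} → S b → T b) → (∀ {b} → T b → S b) → Span S ≐ Span T
Span-cong S⊆T T⊆S y _ = mk⇔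
  (λ (z , Sz , z≈y) → z , All.map S⊆T Sz , z≈y)
  (λ (z , Tz , z≈y) → z , All.map T⊆S Tz , z≈y)

-- The relation `≐` only compares sums of symbols of 𝓑, so `Elt-br` is what allows it to be applied
-- to `br y z`.
Idealizer-cong : ∀ {A B : Pred𝔏 n} → A ≐ B → Idealizer A ≐ Idealizer B
Idealizer-cong A≐B y y∈ = mk⇔
  (λ idA z z∈ Bz → Equivalence.to (A≐B (br y z) (Elt-br y z y∈ z∈)) (idA z z∈ (Equivalence.from (A≐B z z∈) Bz)))
  (λ idB z z∈ Az → Equivalence.from (A≐B (br y z) (Elt-br y z y∈ z∈)) (idB z z∈ (Equivalence.to (A≐B z z∈) Az)))

-- The idealizer chain

InB? : Decidable (InB {n})
InB? b = Fin.all? λ t → (toℕ (dk b) ℕ.≤? toℕ t) →-dec (lookup (exp b) t ℕ.≟ 0)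

𝒩? : ∀ n m → Decidable (𝒩 n m)
𝒩? n m b = InB? b ×-dec map′
  (λ (j′ , j′<1+m , p) → j′ , ℕ.≤-pred j′<1+m , p)
  (λ (j′ , j′≤m , p) → j′ , s≤s j′≤m , p)
  -- The search bound is strict, hence `suc m`.
  (ℕ.anyUpTo? (λ j′ → lev (+ j′ ℤ.- + 1) b ℤ.≤? (+ j′ ℤ.- + 1)) (suc m))

𝒩-mono : ∀ {m} {b : Raw n} → 𝒩 n m b → 𝒩 n (suc m) b
𝒩-mono (b∈ , j′ , j′≤m , p) = b∈ , j′ , ℕ.m≤n⇒m≤1+n j′≤m , p

𝒩-idealizes-0 : ∀ D → IdealizesTo (𝒩 (suc (suc D)) 1) (𝒩 (suc (suc D)) 0)
𝒩-idealizes-0 D = record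
  { T⊆B = proj₁ ; S⊆B = proj₁ ; T? = 𝒩? _ 1 ; S? = 𝒩? _ 0
  ; sound = λ {b} {c} {e} (b∈ , Rb) (c∈ , Rc) b·c → Br-InB b∈ c∈ b·c ,
      Reached-0⁺ e (subst (ℤ._≤ ℤ.-1ℤ) (sym (Br-rdeg b·c))
        (ℤ.+-mono-≤ (Reached-1⁻ b b∈ Rb) (Reached-0⁻ c c∈ Rc)))
  ; full = λ {b} b∈ idealizes → b∈ , Reached-1⁺ b (bound b b∈ idealizes) }
  where
  bound : ∀ b → InB b → (∀ {c e} → 𝒩 _ 0 c → Br b c e → 𝒩 _ 0 e) → rdeg b ℤ.≤ 0ℤ
  bound b@(mon k Λ) b∈ idealizes with some-nonzero Λ
  ... | inj₁ refl     = ℤ.≤-trans (ℤ.≤-reflexive (rdeg-∂ k)) ℤ.-≤+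
  -- Differentiating by an occurring variable x_t lowers the reduced degree by one, and the result
  -- must be a pure derivation.
  ... | inj₂ (t , nz) = ≤-shift (subst (ℤ._≤ ℤ.-1ℤ)
      (trans (Br-rdeg b·∂ₜ) (cong (ℤ._+_ (rdeg b)) (rdeg-∂ t)))
      (Reached-0⁻ e (proj₁ 𝒩e) (proj₂ 𝒩e)))
    (identity (rdeg b))
    where
    e = mon k (zipWith ℕ._+_ (decr Λ t) (replicate _ 0))
    b·∂ₜ : Br b (∂ t) e
    b·∂ₜ = down (InB⇒< {b = b} b∈ t nz) nz
    𝒩e : 𝒩 _ 0 e
    𝒩e = idealizes (∂∈B t , Reached-0⁺ (∂ t) (ℤ.≤-reflexive (rdeg-∂ t))) b·∂ₜ
    identity : ∀ d → ℤ.-1ℤ ℤ.- (d ℤ.+ ℤ.-1ℤ) ≡ 0ℤ ℤ.- d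
    identity = solve-∀

probe-level : ∀ {D} h r (q : Fin (suc D)) → InLevel h r (probe h q)
probe-level {D} h r q = subst₂ (Level (suc D) h r) (sym (gap-probe h q)) (sym (rdeg-probe h q))
  (inj₁ (ℤ.≤-reflexive (sym (ℤ.*-identityʳ (+ h)))))

InLevel-via-probe : ∀ {D} h r (b : Raw (suc (suc D))) →
  (∀ {c e} → InB c → InLevel h r c → Br b c e → InLevel h r e) →
  ∀ q {e} → Br b (probe h q) e → InLevel h (suc r) b
InLevel-via-probe {D} h r b idealizes q b·c = Level-probe h r (subst₂ (Level (suc D) h r)
  (trans (Br-gap b·c) (cong (ℤ._+_ (gap b)) (gap-probe h q)))
  (trans (Br-rdeg b·c) (cong (ℤ._+_ (rdeg b)) (rdeg-probe h q)))
  (idealizes (probe∈B h q) (probe-level h r q) b·c))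

-- Every symbol except the x_1^m ∂_n has a non-zero bracket with some `probe h q`. The exceptions
-- have gap n - 1 and are settled directly for m = 0 and by ∂_1 for m > 0.
InLevel-full : ∀ {D} h r (b : Raw (suc (suc D))) → InB b →
  (∀ {c e} → InB c → InLevel h r c → Br b c e → InLevel h r e) → InLevel h (suc r) b
InLevel-full {D} h r b@(mon k (x ∷ Λ)) b∈ idealizes with toℕ k ℕ.≟ suc D
-- Below the top derivation, the probe is chosen to contain the variable that `b` differentiates.
... | no k≢D = InLevel-via-probe h r b idealizes q (up {k = k} k<q+1
        (subst (λ t → lookup (exp (probe h q)) t ≢ 0) (Fin.inject₁-lower₁ k (k≢D ∘ sym))
          (lookup-incr≢0 (h ∷ replicate (suc D) 0) (Fin.inject₁ q))))
  where
  q : Fin (suc D)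
  q = Fin.lower₁ k (k≢D ∘ sym)
  k<q+1 : toℕ k ℕ.< suc (toℕ q)
  k<q+1 = s≤s (ℕ.≤-reflexive (sym (Fin.toℕ-lower₁ k (k≢D ∘ sym))))
... | yes k≡D with some-nonzero Λ
-- For ∂_n, the probe is chosen so that its derivation hits an occurring variable other than x_1.
...   | inj₂ (q , nz) = InLevel-via-probe h r b idealizes q
        (down (InB⇒< {b = b} b∈ (Fin.suc q) nz) nz)
...   | inj₁ refl     = x-power x refl
  where
  gap≡D : gap b ≡ + suc D
  gap≡D = trans (cong₂ (λ m w → + m ℤ.- + w) k≡D (wsum-zeros {suc D} (suc ∘ toℕ))) (ℤ.+-identityʳ (+ suc D))
  x-power : ∀ x′ → x′ ≡ x → InLevel h (suc r) b
  x-power zero    refl = inj₁ (ℤ.≤-trans (ℤ.≤-reflexive (rdeg-∂ k)) (ℤ.≤-trans ℤ.-≤+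
    (subst₂ ℤ._≤_ (ℤ.*-zeroʳ (+ h)) (cong (+ h ℤ.*_) (sym gap≡D))
      (ℤ.*-monoˡ-≤-nonNeg (+ h) (ℤ.+≤+ z≤n)))))
  x-power (suc _) refl = subst (λ u → Level (suc D) h (suc r) u (rdeg b)) (sym gap≡D)
    (Level-probe₁ h r (subst₂ (Level (suc D) h r)
      (trans (Br-gap b·∂₁) (cong₂ ℤ._+_ gap≡D gap-∂₁))
      (trans (Br-rdeg b·∂₁) (cong (ℤ._+_ (rdeg b)) (rdeg-∂ {suc (suc D)} Fin.zero)))
      (idealizes (∂∈B Fin.zero) ∂₁-level b·∂₁)))
    where
    b·∂₁ : Br b (∂ Fin.zero) _
    b·∂₁ = down (subst (0 ℕ.<_) (sym k≡D) (s≤s z≤n)) λ ()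
    gap-∂₁ : gap (∂ {suc (suc D)} Fin.zero) ≡ 0ℤ
    gap-∂₁ = cong (λ m → 0ℤ ℤ.- + m) (wsum-zeros {suc (suc D)} toℕ)
    ∂₁-level : InLevel h r (∂ {suc (suc D)} Fin.zero)
    ∂₁-level = subst₂ (Level (suc D) h r) (sym gap-∂₁) (sym (rdeg-∂ {suc (suc D)} Fin.zero))
      (inj₁ (subst (ℤ.-1ℤ ℤ.≤_) (sym (ℤ.*-zeroʳ (+ h))) ℤ.-≤+))

𝒩-idealizes-suc : ∀ D h r → r ℕ.< suc D →
  IdealizesTo (𝒩 (suc (suc D)) (suc (suc r ℕ.+ h ℕ.* suc D))) (𝒩 (suc (suc D)) (suc (r ℕ.+ h ℕ.* suc D)))
𝒩-idealizes-suc D h r r<D = record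
  { T⊆B = proj₁ ; S⊆B = proj₁ ; T? = 𝒩? _ _ ; S? = 𝒩? _ _
  ; sound = λ {b} {c} {e} (b∈ , Rb) (c∈ , Rc) b·c → let e∈ = Br-InB b∈ c∈ b·c in
      e∈ , Level⇒Reached e e∈ h r (ℕ.<⇒≤ r<D)
        (subst₂ (Level (suc D) h r) (sym (Br-gap b·c)) (sym (Br-rdeg b·c))
          (Level-+ h r r<D (InB⇒Admissible b b∈) (InB⇒Admissible c c∈)
            (Reached⇒Level b b∈ h (suc r) r<D Rb) (Reached⇒Level c c∈ h r (ℕ.<⇒≤ r<D) Rc)))
  ; full = λ {b} b∈ idealizes → b∈ , Level⇒Reached b b∈ h (suc r) r<D
      (InLevel-full h r b b∈ λ {c} {e} c∈ Lc b·c →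
        let e∈ , Re = idealizes (c∈ , Level⇒Reached c c∈ h r (ℕ.<⇒≤ r<D) Lc) b·c
        in Reached⇒Level e e∈ h r (ℕ.<⇒≤ r<D) Re) }

𝒩-idealizes : ∀ D m → IdealizesTo (𝒩 (suc (suc D)) (suc m)) (𝒩 (suc (suc D)) m)
𝒩-idealizes D zero    = 𝒩-idealizes-0 D
-- Index `suc m` stands for i = m, which division by n - 1 writes as r + h(n - 1). As r < n - 1,
-- passing to `suc r` stays in the block.
𝒩-idealizes D (suc m) = subst
  (λ i → IdealizesTo (𝒩 (suc (suc D)) (suc (suc i))) (𝒩 (suc (suc D)) (suc i)))
  (sym (m≡m%n+[m/n]*n m (suc D)))
  (𝒩-idealizes-suc D (m ℕ./ suc D) (m ℕ.% suc D) (m%n<n m (suc D)))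

𝔐-0 : ∀ D → 𝔐 (suc (suc D)) 0 ≐ chain (suc (suc D)) 0
𝔐-0 D = Span-cong 𝒩₀⇒deriv deriv⇒𝒩₀
  where
  𝒩₀⇒deriv : ∀ {b} → 𝒩 (suc (suc D)) 0 b → IsDeriv b
  𝒩₀⇒deriv {b@(mon k Λ)} (b∈ , Rb) with some-nonzero Λ
  ... | inj₁ eq       = eq
  -- A non-zero exponent exhibits `deg Λ` as a successor, which contradicts reduced degree at most
  -- -1.
  ... | inj₂ (t , nz) = contradiction
    (subst (λ m → + m ℤ.- 1ℤ ℤ.≤ ℤ.-1ℤ)
      (trans (sym (wsum-1 Λ)) (sym (wsum-decr (const 1) Λ t nz)))
      (Reached-0⁻ b b∈ Rb)) λ ()
  deriv⇒𝒩₀ : ∀ {b} → IsDeriv b → 𝒩 (suc (suc D)) 0 b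
  deriv⇒𝒩₀ {mon k _} refl = ∂∈B k , Reached-0⁺ (∂ k) (ℤ.≤-reflexive (rdeg-∂ k))

𝔐≐chain : ∀ D m → 𝔐 (suc (suc D)) m ≐ chain (suc (suc D)) m
𝔐≐chain D zero    = 𝔐-0 D
𝔐≐chain D (suc m) = ≐-trans (Span≐Idealizer (𝒩-idealizes D m)) (Idealizer-cong (𝔐≐chain D m))

theorem3p4 : (n : ℕ) → 2 ≤ n →
    (𝔐 n 0 ≐ chain n 0) ×
    ((i : ℕ) →
    IsLieSubring (𝔐 n (suc i)) × IsHomogeneous (𝔐 n (suc i)) ×
    (𝔐 n (suc i) ≐ Idealizer (𝔐 n i)) ×
    (𝔐 n (suc i) ≐ chain n (suc i)))
theorem3p4 (suc (suc D)) (s≤s (s≤s z≤n)) = 𝔐-0 D , λ i →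
  Span-isLieSubring (𝒩? (suc (suc D)) (suc i))
    -- Closure under the bracket comes from the next link of the chain, because 𝒩_i is contained in
    -- 𝒩_{i+1}, which idealizes it.
    (λ {b} b∈ → IdealizesTo.sound (𝒩-idealizes D (suc i)) (𝒩-mono {b = b} b∈)) ,
  (𝒩 (suc (suc D)) (suc i) , (λ _ → proj₁) , ≐-refl) ,
  Span≐Idealizer (𝒩-idealizes D i) ,
  𝔐≐chain D (suc i)
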